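{- Let $\mathcal L$ be a differential Seely category with comonad $(!,\mathbf d,\mathbf p)$ and let $\mathcal L_!$ be its co-Kleisli category. Then the canonical linear-non-linear adjunction between $\mathcal L_!$ and $\mathcal L$ (with $\mathcal F:\mathcal L_!\to\mathcal L$, $A\mapsto !A$, $f\mapsto\mathbf p_A;!f$ for $f:!A\to B$, and $\mathcal U:\mathcal L\to\mathcal L_!$, $A\mapsto A$, $u\mapsto\mathbf d_A;u$) is a generalised differential Seely category, i.e. it admits a functor $\mathcal T:\mathcal L_!\to LS(\mathcal L_!)$ satisfying axioms (t.1), (t.2), (t.3).
   Context: Composition is diagrammatic ($f;g$ = $f$ then $g$); monoidal categories are strict. Differential Seely category: an additive symmetric monoidal category $(\mathcal L,\otimes,1)$ (enriched over commutative monoids with $\otimes$ bilinear and preserving $0$) with finite products, which are biproducts $\oplus$ (projections $\pi_i$, injections $\iota_i$), and a comonad $(!,\mathbf d,\mathbf p)$ with Seely isomorphisms $!(A\oplus B)\cong!A\otimes!B$, $!0\cong1$ (so the co-Kleisli category $\mathcal L_!$ is cartesian, with products $\oplus$, and the co-Kleisli adjunction is a symmetric monoidal adjunction; each $!A$ is a commutative comonoid with contraction $\mathbf c_A$ and weakening $\mathbf w_A$), together with a natural $\partial_A:!A\otimes A\to!A$ satisfying: $\partial_A;\mathbf w_A=0$; $\partial_A;\mathbf c_A=(\mathbf c_A\otimes\mathrm{id}_A);[(\mathrm{id}_{!A}\otimes\partial_A)+(\mathrm{id}_{!A}\otimes\sigma_{!A,A};\partial_A\otimes\mathrm{id}_{!A})]$;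 $\partial_A;\mathbf d_A=\mathbf w_A\otimes\mathrm{id}_A$; $\partial_A;\mathbf p_A=(\mathbf c_A\otimes\mathrm{id}_A);(\mathbf p_A\otimes\partial_A);\partial_{!A}$; $(\mathrm{id}_{!A}\otimes\sigma_{A,A});(\partial_A\otimes\mathrm{id}_A);\partial_A=(\partial_A\otimes\mathrm{id}_A);\partial_A$. General notions, for an LNL adjunction $\mathcal F\dashv\mathcal U$, $\mathcal F:\mathscr C\to\mathcal L$, between a cartesian $(\mathscr C,\times,I)$ and symmetric monoidal $(\mathcal L,\otimes,1)$, with $\mathcal U$ lax monoidal via $n_{A,B}:\mathcal U(A)\times\mathcal U(B)\to\mathcal U(A\otimes B)$, $\mathcal F$ strong monoidal via $m_{X,Y}:\mathcal F(X)\otimes\mathcal F(Y)\to\mathcal F(X\times Y)$, $m_1:1\to\mathcal F(I)$, unit $\eta$: $\mathbf c_X:=\mathcal F(\Delta_X);m_{X,X}^{ -1}$, $\mathbf w_X:=\mathcal F(t_X);m_1^{ -1}$ ($t_X$ terminal). $LS(\mathscr C)$ has objects $(X,A)$ ($X\in\mathscr C$, $A\in\mathcal L$), morphisms $(f,u):(X,A)\to(Y,B)$ with $f:X\to Y$, $u:\mathcal F(X)\otimes A\to B$, composition $(f,u);(g,v)=(f;g,(\mathbf c_X\otimes\mathrm{id}_A);(\mathcal F(f)\otimes u);v)$, identity $(\mathrm{id}_X,\mathbf w_X\otimes\mathrm{id}_A)$, projection $\mathbf{ls}(f,u)=f$; when $\mathcal L$ has biproducts, $LS(\mathscr C)$ has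 products $(X,A)\times(Y,B)=(X\times Y,A\oplus B)$ with projections $(\pi_i,\mathbf w_{X\times Y}\otimes\pi_i)$. Axioms for $\mathcal T:\mathscr C\to LS(\mathscr C)$: (t.1) $\mathbf{ls}\circ\mathcal T=\mathrm{id}$ (so $\mathcal T(X)=(X,\lambda(X))$) and $\varphi_{X,Y}:=\langle\mathcal T(\pi_1),\mathcal T(\pi_2)\rangle:\mathcal T(X\times Y)\to(X\times Y,\lambda(X)\oplus\lambda(Y))$ is an isomorphism; (t.2) $\mathcal T(\mathcal U(A))=(\mathcal U(A),A)$; (t.3) with $i^{X,Y}_2:=(\mathrm{id}_{X\times Y},\mathbf w_{X\times Y}\otimes\iota_2);\varphi_{X,Y}^{ -1}$, $⦃(f,u)⦄:=\langle\pi_1;f,(\eta_X\times\mathrm{id}_{\mathcal U(A)});n_{\mathcal F(X),A};\mathcal U(u)\rangle:X\times\mathcal U(A)\to Y\times\mathcal U(B)$, $W(f,u):=(⦃(f,u)⦄,(\mathcal F(\pi_1)\otimes\mathrm{id}_A);u):(X\times\mathcal U(A),A)\to(Y\times\mathcal U(B),B)$: $W(f,u);i^{Y,\mathcal U(B)}_2=i^{X,\mathcal U(A)}_2;\mathcal T(⦃(f,u)⦄)$ for all $(f,u):(X,A)\to(Y,B)$. A GDSC is such an LNL with $\mathcal L$ additive with finite products and such a $\mathcal T$. -}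

module Defs where

open import Level using (Level; _⊔_) renaming (suc to lsuc)
open import Data.Product using (_×_; _,_; proj₁; proj₂)
open import Relation.Binary using (IsEquivalence; Setoid)
open import Relation.Binary.PropositionalEquality using (_≡_; refl; sym; cong; cong₂)
open import Algebra.Structures using (IsCommutativeMonoid)
import Relation.Binary.Reasoning.Setoid as SetoidReasoning

-- Composition is diagrammatic: f ⨾ g is "f, then g".
record Category (o ℓ e : Level) : Set (lsuc (o ⊔ ℓ ⊔ e)) where
  infix  4 _≈_
  infix  5 _⇒_
  infixr 9 _⨾_
  field
    Obj : Set o
    _⇒_ : Obj → Obj → Set ℓ
    _≈_ : ∀ {A B} → A ⇒ B → A ⇒ B → Set e
    id  : ∀ {A} → A ⇒ A
    _⨾_ : ∀ {A B C} → A ⇒ B → B ⇒ C → A ⇒ C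

    equiv     : ∀ {A B} → IsEquivalence (_≈_ {A} {B})
    assoc     : ∀ {A B C D} {f : A ⇒ B} {g : B ⇒ C} {h : C ⇒ D} →
                (f ⨾ g) ⨾ h ≈ f ⨾ (g ⨾ h)
    identityˡ : ∀ {A B} {f : A ⇒ B} → id ⨾ f ≈ f
    identityʳ : ∀ {A B} {f : A ⇒ B} → f ⨾ id ≈ f
    ⨾-cong    : ∀ {A B C} {f f′ : A ⇒ B} {g g′ : B ⇒ C} →
                f ≈ f′ → g ≈ g′ → f ⨾ g ≈ f′ ⨾ g′

  module _ {A B : Obj} where
    open IsEquivalence (equiv {A} {B}) public
      using () renaming (refl to ≈-refl; sym to ≈-sym; trans to ≈-trans)

  hom-setoid : ∀ {A B} → Setoid ℓ e
  hom-setoid {A} {B} = record { Carrier = A ⇒ B ; _≈_ = _≈_ ; isEquivalence = equiv }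

  module HomReasoning {A B : Obj} = SetoidReasoning (hom-setoid {A} {B})

  record IsIso {A B : Obj} (f : A ⇒ B) : Set (ℓ ⊔ e) where
    field
      inv  : B ⇒ A
      isoˡ : f ⨾ inv ≈ id
      isoʳ : inv ⨾ f ≈ id

  cast : ∀ {A B} → A ≡ B → A ⇒ B
  cast refl = id

  ⨾-congˡ : ∀ {A B C} {f : A ⇒ B} {g g′ : B ⇒ C} → g ≈ g′ → f ⨾ g ≈ f ⨾ g′
  ⨾-congˡ = ⨾-cong ≈-refl

  ⨾-congʳ : ∀ {A B C} {f f′ : A ⇒ B} {g : B ⇒ C} → f ≈ f′ → f ⨾ g ≈ f′ ⨾ g
  ⨾-congʳ p = ⨾-cong p ≈-refl

  pull : ∀ {A B C D} {f : A ⇒ B} {g : B ⇒ C} {k : A ⇒ C} {h : C ⇒ D} →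
         f ⨾ g ≈ k → f ⨾ g ⨾ h ≈ k ⨾ h
  pull p = ≈-trans (≈-sym assoc) (⨾-congʳ p)

  swap : ∀ {A B B′ C D} {f : A ⇒ B} {g : B ⇒ C} {f′ : A ⇒ B′} {g′ : B′ ⇒ C} {h : C ⇒ D} →
         f ⨾ g ≈ f′ ⨾ g′ → f ⨾ g ⨾ h ≈ f′ ⨾ g′ ⨾ h
  swap p = ≈-trans (pull p) assoc

  cancel : ∀ {A B D} {f : A ⇒ B} {g : B ⇒ A} {h : A ⇒ D} →
           f ⨾ g ≈ id → f ⨾ g ⨾ h ≈ h
  cancel p = ≈-trans (pull p) identityˡ

record Functor {o ℓ e o′ ℓ′ e′} (C : Category o ℓ e) (D : Category o′ ℓ′ e′)
    : Set (o ⊔ ℓ ⊔ e ⊔ o′ ⊔ ℓ′ ⊔ e′) where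
  private
    module C = Category C
    module D = Category D
  field
    F₀ : C.Obj → D.Obj
    F₁ : ∀ {A B} → A C.⇒ B → F₀ A D.⇒ F₀ B
    F-id   : ∀ {A} → F₁ (C.id {A}) D.≈ D.id
    F-⨾    : ∀ {A B C} {f : A C.⇒ B} {g : B C.⇒ C} → F₁ (f C.⨾ g) D.≈ F₁ f D.⨾ F₁ g
    F-cong : ∀ {A B} {f g : A C.⇒ B} → f C.≈ g → F₁ f D.≈ F₁ g

idF : ∀ {o ℓ e} {C : Category o ℓ e} → Functor C C
idF {C = C} = record
  { F₀ = λ A → A ; F₁ = λ f → f ; F-id = ≈-refl ; F-⨾ = ≈-refl ; F-cong = λ p → p }
  where open Category C

_⨾F_ : ∀ {o ℓ e o′ ℓ′ e′ o″ ℓ″ e″}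
       {C : Category o ℓ e} {D : Category o′ ℓ′ e′} {E : Category o″ ℓ″ e″} →
       Functor C D → Functor D E → Functor C E
_⨾F_ {E = E} F G = record
  { F₀     = λ A → G.F₀ (F.F₀ A)
  ; F₁     = λ f → G.F₁ (F.F₁ f)
  ; F-id   = ≈-trans (G.F-cong F.F-id) G.F-id
  ; F-⨾    = ≈-trans (G.F-cong F.F-⨾) G.F-⨾
  ; F-cong = λ p → G.F-cong (F.F-cong p)
  }
  where
    open Category E
    module F = Functor F
    module G = Functor G

-- Strict equality of functors: equal on objects and, modulo the induced
-- casts, on morphisms.
record _≡F_ {o ℓ e o′ ℓ′ e′} {C : Category o ℓ e} {D : Category o′ ℓ′ e′}
    (F G : Functor C D) : Set (o ⊔ ℓ ⊔ o′ ⊔ e′) where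
  private
    module C = Category C
    module F = Functor F
    module G = Functor G
  open Category D
  field
    obj≡ : ∀ A → F.F₀ A ≡ G.F₀ A
    mor≈ : ∀ {A B} (f : A C.⇒ B) → F.F₁ f ⨾ cast (obj≡ B) ≈ cast (obj≡ A) ⨾ G.F₁ f

record NaturalTransformation {o ℓ e o′ ℓ′ e′} {C : Category o ℓ e} {D : Category o′ ℓ′ e′}
    (F G : Functor C D) : Set (o ⊔ ℓ ⊔ ℓ′ ⊔ e′) where
  private
    module C = Category C
    module F = Functor F
    module G = Functor G
  open Category D
  field
    at      : ∀ A → F.F₀ A ⇒ G.F₀ A
    natural : ∀ {A B} (f : A C.⇒ B) → F.F₁ f ⨾ at B ≈ at A ⨾ G.F₁ f

-- Not assumed strict: equations stated strictly in the literature carry the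
-- evident associators and unitors below.
record SymmetricMonoidal {o ℓ e} (C : Category o ℓ e) : Set (o ⊔ ℓ ⊔ e) where
  open Category C
  infixr 10 _⊗₀_ _⊗₁_
  field
    _⊗₀_ : Obj → Obj → Obj
    _⊗₁_ : ∀ {A B A′ B′} → A ⇒ B → A′ ⇒ B′ → A ⊗₀ A′ ⇒ B ⊗₀ B′
    unit : Obj

    ⊗-id   : ∀ {A B} → id {A} ⊗₁ id {B} ≈ id
    ⊗-⨾    : ∀ {A B C A′ B′ C′} {f : A ⇒ B} {g : B ⇒ C} {f′ : A′ ⇒ B′} {g′ : B′ ⇒ C′} →
             (f ⨾ g) ⊗₁ (f′ ⨾ g′) ≈ (f ⊗₁ f′) ⨾ (g ⊗₁ g′)
    ⊗-cong : ∀ {A B A′ B′} {f g : A ⇒ B} {f′ g′ : A′ ⇒ B′} →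
             f ≈ g → f′ ≈ g′ → f ⊗₁ f′ ≈ g ⊗₁ g′

    α⇒ : ∀ {A B C} → (A ⊗₀ B) ⊗₀ C ⇒ A ⊗₀ (B ⊗₀ C)
    λ⇒ : ∀ {A} → unit ⊗₀ A ⇒ A
    ρ⇒ : ∀ {A} → A ⊗₀ unit ⇒ A
    σ  : ∀ {A B} → A ⊗₀ B ⇒ B ⊗₀ A

    α-iso : ∀ {A B C} → IsIso (α⇒ {A} {B} {C})
    λ-iso : ∀ {A} → IsIso (λ⇒ {A})
    ρ-iso : ∀ {A} → IsIso (ρ⇒ {A})

    α-natural : ∀ {A B C A′ B′ C′} {f : A ⇒ A′} {g : B ⇒ B′} {h : C ⇒ C′} →
                ((f ⊗₁ g) ⊗₁ h) ⨾ α⇒ ≈ α⇒ ⨾ (f ⊗₁ (g ⊗₁ h))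
    λ-natural : ∀ {A B} {f : A ⇒ B} → (id ⊗₁ f) ⨾ λ⇒ ≈ λ⇒ ⨾ f
    ρ-natural : ∀ {A B} {f : A ⇒ B} → (f ⊗₁ id) ⨾ ρ⇒ ≈ ρ⇒ ⨾ f
    σ-natural : ∀ {A B A′ B′} {f : A ⇒ A′} {g : B ⇒ B′} →
                (f ⊗₁ g) ⨾ σ ≈ σ ⨾ (g ⊗₁ f)

    triangle : ∀ {A B} → α⇒ {A} {unit} {B} ⨾ (id ⊗₁ λ⇒) ≈ ρ⇒ ⊗₁ id
    pentagon : ∀ {A B C D} →
               (α⇒ {A} {B} {C} ⊗₁ id {D}) ⨾ α⇒ ⨾ (id ⊗₁ α⇒) ≈ α⇒ ⨾ α⇒
    σ-involutive : ∀ {A B} → σ {A} {B} ⨾ σ ≈ id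
    hexagon  : ∀ {A B C} →
               α⇒ {A} {B} {C} ⨾ σ ⨾ α⇒ ≈ (σ ⊗₁ id) ⨾ α⇒ ⨾ (id ⊗₁ σ)

  α⇐ : ∀ {A B C} → A ⊗₀ (B ⊗₀ C) ⇒ (A ⊗₀ B) ⊗₀ C
  α⇐ = IsIso.inv α-iso

  ⊗-congˡ : ∀ {A B A′ B′} {f : A ⇒ B} {f′ g′ : A′ ⇒ B′} → f′ ≈ g′ → f ⊗₁ f′ ≈ f ⊗₁ g′
  ⊗-congˡ = ⊗-cong ≈-refl

  ⊗-congʳ : ∀ {A B A′ B′} {f g : A ⇒ B} {f′ : A′ ⇒ B′} → f ≈ g → f ⊗₁ f′ ≈ g ⊗₁ f′
  ⊗-congʳ p = ⊗-cong p ≈-refl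

  ⊗-merge : ∀ {A B C A′ B′ C′} {f : A ⇒ B} {g : B ⇒ C} {h : A ⇒ C}
              {f′ : A′ ⇒ B′} {g′ : B′ ⇒ C′} {h′ : A′ ⇒ C′} →
            f ⨾ g ≈ h → f′ ⨾ g′ ≈ h′ → (f ⊗₁ f′) ⨾ (g ⊗₁ g′) ≈ h ⊗₁ h′
  ⊗-merge p q = ≈-trans (≈-sym ⊗-⨾) (⊗-cong p q)

  -- The coherence law α ⨾ λ = λ ⊗ id, derived from triangle and pentagon.
  λ-coherence : ∀ {A B} → α⇒ {unit} {A} {B} ⨾ λ⇒ ≈ λ⇒ ⊗₁ id
  λ-coherence {A} {B} = begin
      α⇒ ⨾ λ⇒                                ≈⟨ ⨾-congˡ (cancel lu.isoʳ) ⟨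
      α⇒ ⨾ lu.inv ⨾ λ⇒ ⨾ λ⇒                   ≈⟨ ⨾-congˡ (⨾-congˡ λ-natural) ⟨
      α⇒ ⨾ lu.inv ⨾ (id ⊗₁ λ⇒) ⨾ λ⇒           ≈⟨ swap λinv-natural ⟩
      lu.inv ⨾ (id ⊗₁ α⇒) ⨾ (id ⊗₁ λ⇒) ⨾ λ⇒   ≈⟨ ⨾-congˡ (pull key) ⟩
      lu.inv ⨾ (id ⊗₁ (λ⇒ ⊗₁ id)) ⨾ λ⇒        ≈⟨ ⨾-congˡ λ-natural ⟩
      lu.inv ⨾ λ⇒ ⨾ (λ⇒ ⊗₁ id)                ≈⟨ cancel lu.isoʳ ⟩
      λ⇒ ⊗₁ id                               ∎
    where
      open HomReasoning
      module lu {A : Obj} = IsIso (λ-iso {A})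
      module as {A B C : Obj} = IsIso (α-iso {A} {B} {C})
      λinv-natural : ∀ {A B} {f : A ⇒ B} → f ⨾ lu.inv ≈ lu.inv ⨾ (id ⊗₁ f)
      λinv-natural {f = f} = begin
        f ⨾ lu.inv                           ≈⟨ cancel lu.isoʳ ⟨
        lu.inv ⨾ λ⇒ ⨾ f ⨾ lu.inv              ≈⟨ ⨾-congˡ (swap λ-natural) ⟨
        lu.inv ⨾ (id ⊗₁ f) ⨾ λ⇒ ⨾ lu.inv      ≈⟨ ⨾-congˡ (⨾-congˡ lu.isoˡ) ⟩
        lu.inv ⨾ (id ⊗₁ f) ⨾ id              ≈⟨ ⨾-congˡ identityʳ ⟩
        lu.inv ⨾ (id ⊗₁ f)                   ∎
      pre : ∀ {X} {f g : (unit ⊗₀ ((unit ⊗₀ A) ⊗₀ B)) ⇒ X} →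
            (α⇒ ⊗₁ id) ⨾ α⇒ ⨾ f ≈ (α⇒ ⊗₁ id) ⨾ α⇒ ⨾ g → f ≈ g
      pre {f = f} {g} p = begin
          f                                                   ≈⟨ undo ⟨
          as.inv ⨾ (as.inv ⊗₁ id) ⨾ (α⇒ ⊗₁ id) ⨾ α⇒ ⨾ f         ≈⟨ ⨾-congˡ (⨾-congˡ p) ⟩
          as.inv ⨾ (as.inv ⊗₁ id) ⨾ (α⇒ ⊗₁ id) ⨾ α⇒ ⨾ g         ≈⟨ undo ⟩
          g                                                   ∎
        where
          undo : ∀ {X} {h : (unit ⊗₀ ((unit ⊗₀ A) ⊗₀ B)) ⇒ X} →
                 as.inv ⨾ (as.inv ⊗₁ id) ⨾ (α⇒ ⊗₁ id) ⨾ α⇒ ⨾ h ≈ h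
          undo = ≈-trans (⨾-congˡ (cancel (≈-trans (⊗-merge as.isoʳ identityˡ) ⊗-id)))
                         (cancel as.isoʳ)
      key : (id ⊗₁ α⇒) ⨾ (id ⊗₁ λ⇒) ≈ id {unit} ⊗₁ (λ⇒ {A} ⊗₁ id {B})
      key = pre (begin
        (α⇒ ⊗₁ id) ⨾ α⇒ ⨾ (id ⊗₁ α⇒) ⨾ (id ⊗₁ λ⇒)  ≈⟨ ⨾-congˡ assoc ⟨
        (α⇒ ⊗₁ id) ⨾ (α⇒ ⨾ (id ⊗₁ α⇒)) ⨾ (id ⊗₁ λ⇒) ≈⟨ swap pentagon ⟩
        α⇒ ⨾ α⇒ ⨾ (id ⊗₁ λ⇒)                       ≈⟨ ⨾-congˡ triangle ⟩
        α⇒ ⨾ (ρ⇒ ⊗₁ id)                            ≈⟨ ⨾-congˡ (⊗-congˡ ⊗-id) ⟨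
        α⇒ ⨾ (ρ⇒ ⊗₁ (id ⊗₁ id))                    ≈⟨ α-natural ⟨
        ((ρ⇒ ⊗₁ id) ⊗₁ id) ⨾ α⇒                    ≈⟨ ⨾-congʳ (⊗-merge triangle identityˡ) ⟨
        ((α⇒ ⊗₁ id) ⨾ ((id ⊗₁ λ⇒) ⊗₁ id)) ⨾ α⇒     ≈⟨ assoc ⟩
        (α⇒ ⊗₁ id) ⨾ ((id ⊗₁ λ⇒) ⊗₁ id) ⨾ α⇒       ≈⟨ ⨾-congˡ α-natural ⟩
        (α⇒ ⊗₁ id) ⨾ α⇒ ⨾ (id ⊗₁ (λ⇒ ⊗₁ id))       ∎)

record LaxSymmetricMonoidal {o ℓ e o′ ℓ′ e′} {C : Category o ℓ e} {D : Category o′ ℓ′ e′}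
    (M : SymmetricMonoidal C) (N : SymmetricMonoidal D) (F : Functor C D)
    : Set (o ⊔ ℓ ⊔ ℓ′ ⊔ e′) where
  private
    module C = Category C
    module M = SymmetricMonoidal M
  open Category D
  open SymmetricMonoidal N
  open Functor F
  field
    μ  : ∀ {A B} → F₀ A ⊗₀ F₀ B ⇒ F₀ (A M.⊗₀ B)
    μ₀ : unit ⇒ F₀ M.unit

    μ-natural : ∀ {A B A′ B′} {f : A C.⇒ A′} {g : B C.⇒ B′} →
                (F₁ f ⊗₁ F₁ g) ⨾ μ ≈ μ ⨾ F₁ (f M.⊗₁ g)
    μ-assoc : ∀ {A B C} → (μ {A} {B} ⊗₁ id {F₀ C}) ⨾ μ ⨾ F₁ M.α⇒ ≈ α⇒ ⨾ (id ⊗₁ μ) ⨾ μ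
    μ-unitˡ : ∀ {A} → (μ₀ ⊗₁ id {F₀ A}) ⨾ μ ⨾ F₁ M.λ⇒ ≈ λ⇒
    μ-unitʳ : ∀ {A} → (id {F₀ A} ⊗₁ μ₀) ⨾ μ ⨾ F₁ M.ρ⇒ ≈ ρ⇒
    μ-sym   : ∀ {A B} → μ {A} {B} ⨾ F₁ M.σ ≈ σ ⨾ μ

record StrongSymmetricMonoidal {o ℓ e o′ ℓ′ e′} {C : Category o ℓ e} {D : Category o′ ℓ′ e′}
    (M : SymmetricMonoidal C) (N : SymmetricMonoidal D) (F : Functor C D)
    : Set (o ⊔ ℓ ⊔ ℓ′ ⊔ e′) where
  open Category D
  field
    lax : LaxSymmetricMonoidal M N F
  open LaxSymmetricMonoidal lax public
  field
    μ-iso  : ∀ {A B} → IsIso (μ {A} {B})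
    μ₀-iso : IsIso μ₀

  module _ {A B : Category.Obj C} where
    open IsIso (μ-iso {A} {B}) public
      renaming (inv to μ⁻¹; isoˡ to μ-isoˡ; isoʳ to μ-isoʳ)
  open IsIso μ₀-iso public
    renaming (inv to μ₀⁻¹; isoˡ to μ₀-isoˡ; isoʳ to μ₀-isoʳ)

  private
    module C = Category C
    module M = SymmetricMonoidal M
  open SymmetricMonoidal N
  open Functor F
  open HomReasoning

  μ⁻¹-natural : ∀ {A B A′ B′} {f : A C.⇒ A′} {g : B C.⇒ B′} →
                F₁ (f M.⊗₁ g) ⨾ μ⁻¹ ≈ μ⁻¹ ⨾ (F₁ f ⊗₁ F₁ g)
  μ⁻¹-natural {f = f} {g} = begin
    F₁ (f M.⊗₁ g) ⨾ μ⁻¹               ≈⟨ cancel μ-isoʳ ⟨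
    μ⁻¹ ⨾ μ ⨾ F₁ (f M.⊗₁ g) ⨾ μ⁻¹     ≈⟨ ⨾-congˡ (swap μ-natural) ⟨
    μ⁻¹ ⨾ (F₁ f ⊗₁ F₁ g) ⨾ μ ⨾ μ⁻¹    ≈⟨ ⨾-congˡ (≈-trans (⨾-congˡ μ-isoˡ) identityʳ) ⟩
    μ⁻¹ ⨾ (F₁ f ⊗₁ F₁ g)              ∎

  μ⁻¹-assoc : ∀ {A B C} → μ⁻¹ ⨾ (μ⁻¹ {A} {B} ⊗₁ id {F₀ C}) ⨾ α⇒ ≈ F₁ M.α⇒ ⨾ μ⁻¹ ⨾ (id ⊗₁ μ⁻¹)
  μ⁻¹-assoc = begin
    μ⁻¹ ⨾ (μ⁻¹ ⊗₁ id) ⨾ α⇒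
      ≈⟨ ⨾-congˡ (⨾-congˡ (≈-trans (⨾-congˡ undo) identityʳ)) ⟨
    μ⁻¹ ⨾ (μ⁻¹ ⊗₁ id) ⨾ α⇒ ⨾ (id ⊗₁ μ) ⨾ μ ⨾ μ⁻¹ ⨾ (id ⊗₁ μ⁻¹)
      ≈⟨ ⨾-congˡ (⨾-congˡ (≈-trans (⨾-congˡ (≈-sym assoc)) (≈-trans (≈-sym assoc)
           (≈-trans (⨾-congʳ (≈-sym μ-assoc)) (≈-trans assoc (⨾-congˡ assoc)))))) ⟩
    μ⁻¹ ⨾ (μ⁻¹ ⊗₁ id) ⨾ (μ ⊗₁ id) ⨾ μ ⨾ F₁ M.α⇒ ⨾ μ⁻¹ ⨾ (id ⊗₁ μ⁻¹)
      ≈⟨ ⨾-congˡ (cancel (≈-trans (⊗-merge μ-isoʳ identityˡ) ⊗-id)) ⟩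
    μ⁻¹ ⨾ μ ⨾ F₁ M.α⇒ ⨾ μ⁻¹ ⨾ (id ⊗₁ μ⁻¹)
      ≈⟨ cancel μ-isoʳ ⟩
    F₁ M.α⇒ ⨾ μ⁻¹ ⨾ (id ⊗₁ μ⁻¹) ∎
    where
      undo : ∀ {A B C} → (id {F₀ A} ⊗₁ μ {B} {C}) ⨾ μ ⨾ μ⁻¹ ⨾ (id ⊗₁ μ⁻¹) ≈ id
      undo = ≈-trans (⨾-congˡ (cancel μ-isoˡ)) (≈-trans (⊗-merge identityˡ μ-isoˡ) ⊗-id)

  μ⁻¹-unitˡ : ∀ {A} → μ⁻¹ ⨾ (μ₀⁻¹ ⊗₁ id {F₀ A}) ⨾ λ⇒ ≈ F₁ M.λ⇒
  μ⁻¹-unitˡ = begin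
    μ⁻¹ ⨾ (μ₀⁻¹ ⊗₁ id) ⨾ λ⇒
      ≈⟨ ⨾-congˡ (⨾-congˡ μ-unitˡ) ⟨
    μ⁻¹ ⨾ (μ₀⁻¹ ⊗₁ id) ⨾ (μ₀ ⊗₁ id) ⨾ μ ⨾ F₁ M.λ⇒
      ≈⟨ ⨾-congˡ (cancel (≈-trans (⊗-merge μ₀-isoʳ identityˡ) ⊗-id)) ⟩
    μ⁻¹ ⨾ μ ⨾ F₁ M.λ⇒
      ≈⟨ cancel μ-isoʳ ⟩
    F₁ M.λ⇒ ∎

  μ⁻¹-unitʳ : ∀ {A} → μ⁻¹ ⨾ (id {F₀ A} ⊗₁ μ₀⁻¹) ⨾ ρ⇒ ≈ F₁ M.ρ⇒
  μ⁻¹-unitʳ = begin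
    μ⁻¹ ⨾ (id ⊗₁ μ₀⁻¹) ⨾ ρ⇒
      ≈⟨ ⨾-congˡ (⨾-congˡ μ-unitʳ) ⟨
    μ⁻¹ ⨾ (id ⊗₁ μ₀⁻¹) ⨾ (id ⊗₁ μ₀) ⨾ μ ⨾ F₁ M.ρ⇒
      ≈⟨ ⨾-congˡ (cancel (≈-trans (⊗-merge identityˡ μ₀-isoʳ) ⊗-id)) ⟩
    μ⁻¹ ⨾ μ ⨾ F₁ M.ρ⇒
      ≈⟨ cancel μ-isoʳ ⟩
    F₁ M.ρ⇒ ∎

  μ⁻¹-sym : ∀ {A B} → μ⁻¹ {A} {B} ⨾ σ ≈ F₁ M.σ ⨾ μ⁻¹
  μ⁻¹-sym = begin
    μ⁻¹ ⨾ σ               ≈⟨ ⨾-congˡ (≈-trans (⨾-congˡ μ-isoˡ) identityʳ) ⟨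
    μ⁻¹ ⨾ σ ⨾ μ ⨾ μ⁻¹     ≈⟨ ⨾-congˡ (swap μ-sym) ⟨
    μ⁻¹ ⨾ μ ⨾ F₁ M.σ ⨾ μ⁻¹ ≈⟨ cancel μ-isoʳ ⟩
    F₁ M.σ ⨾ μ⁻¹          ∎

record Cartesian {o ℓ e} (C : Category o ℓ e) : Set (o ⊔ ℓ ⊔ e) where
  open Category C
  infixr 10 _×₀_ _×₁_
  field
    𝟙        : Obj
    ⊤        : ∀ {A} → A ⇒ 𝟙
    ⊤-unique : ∀ {A} {f : A ⇒ 𝟙} → f ≈ ⊤

    _×₀_     : Obj → Obj → Obj
    π₁       : ∀ {A B} → A ×₀ B ⇒ A
    π₂       : ∀ {A B} → A ×₀ B ⇒ B
    ⟨_,_⟩    : ∀ {X A B} → X ⇒ A → X ⇒ B → X ⇒ A ×₀ B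
    project₁ : ∀ {X A B} {f : X ⇒ A} {g : X ⇒ B} → ⟨ f , g ⟩ ⨾ π₁ ≈ f
    project₂ : ∀ {X A B} {f : X ⇒ A} {g : X ⇒ B} → ⟨ f , g ⟩ ⨾ π₂ ≈ g
    unique   : ∀ {X A B} {f : X ⇒ A} {g : X ⇒ B} {h : X ⇒ A ×₀ B} →
               h ⨾ π₁ ≈ f → h ⨾ π₂ ≈ g → h ≈ ⟨ f , g ⟩

  _×₁_ : ∀ {A B A′ B′} → A ⇒ B → A′ ⇒ B′ → A ×₀ A′ ⇒ B ×₀ B′
  f ×₁ g = ⟨ π₁ ⨾ f , π₂ ⨾ g ⟩

  Δ : ∀ {A} → A ⇒ A ×₀ A
  Δ = ⟨ id , id ⟩

  open HomReasoning

  ⟨⟩-cong : ∀ {X A B} {f f′ : X ⇒ A} {g g′ : X ⇒ B} →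
            f ≈ f′ → g ≈ g′ → ⟨ f , g ⟩ ≈ ⟨ f′ , g′ ⟩
  ⟨⟩-cong p q = unique (≈-trans project₁ p) (≈-trans project₂ q)

  ⨾-⟨⟩ : ∀ {W X A B} {h : W ⇒ X} {f : X ⇒ A} {g : X ⇒ B} →
         h ⨾ ⟨ f , g ⟩ ≈ ⟨ h ⨾ f , h ⨾ g ⟩
  ⨾-⟨⟩ = unique (≈-trans assoc (⨾-congˡ project₁)) (≈-trans assoc (⨾-congˡ project₂))

  ⟨π₁,π₂⟩≈id : ∀ {A B} → ⟨ π₁ , π₂ ⟩ ≈ id {A ×₀ B}
  ⟨π₁,π₂⟩≈id = ≈-sym (unique identityˡ identityˡ)

  ⟨⟩-×₁ : ∀ {X A B A′ B′} {a : X ⇒ A} {b : X ⇒ B} {f : A ⇒ A′} {g : B ⇒ B′} →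
          ⟨ a , b ⟩ ⨾ (f ×₁ g) ≈ ⟨ a ⨾ f , b ⨾ g ⟩
  ⟨⟩-×₁ = ≈-trans ⨾-⟨⟩ (⟨⟩-cong (pull project₁) (pull project₂))

  𝟙-ext : ∀ {A} {f g : A ⇒ 𝟙} → f ≈ g
  𝟙-ext = ≈-trans ⊤-unique (≈-sym ⊤-unique)

  ext₂ : ∀ {A B Y} {f g : A ×₀ B ⇒ Y} →
         (∀ {X} (a : X ⇒ A) (b : X ⇒ B) → ⟨ a , b ⟩ ⨾ f ≈ ⟨ a , b ⟩ ⨾ g) → f ≈ g
  ext₂ {f = f} {g} p = begin
    f                  ≈⟨ identityˡ ⟨
    id ⨾ f             ≈⟨ ⨾-congʳ ⟨π₁,π₂⟩≈id ⟨
    ⟨ π₁ , π₂ ⟩ ⨾ f    ≈⟨ p π₁ π₂ ⟩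
    ⟨ π₁ , π₂ ⟩ ⨾ g    ≈⟨ ⨾-congʳ ⟨π₁,π₂⟩≈id ⟩
    id ⨾ g             ≈⟨ identityˡ ⟩
    g                  ∎

  ⟨⟩-η : ∀ {X A B} {a : X ⇒ A ×₀ B} → a ≈ ⟨ a ⨾ π₁ , a ⨾ π₂ ⟩
  ⟨⟩-η = unique ≈-refl ≈-refl

  ext₃ : ∀ {A B C Y} {f g : (A ×₀ B) ×₀ C ⇒ Y} →
         (∀ {X} (a : X ⇒ A) (b : X ⇒ B) (c : X ⇒ C) →
            ⟨ ⟨ a , b ⟩ , c ⟩ ⨾ f ≈ ⟨ ⟨ a , b ⟩ , c ⟩ ⨾ g) → f ≈ g
  ext₃ p = ext₂ λ a b →
    let q = ⟨⟩-cong ⟨⟩-η ≈-refl in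
    ≈-trans (⨾-congʳ q) (≈-trans (p (a ⨾ π₁) (a ⨾ π₂) b) (≈-sym (⨾-congʳ q)))

  ext₄ : ∀ {A B C D Y} {f g : ((A ×₀ B) ×₀ C) ×₀ D ⇒ Y} →
         (∀ {X} (a : X ⇒ A) (b : X ⇒ B) (c : X ⇒ C) (d : X ⇒ D) →
            ⟨ ⟨ ⟨ a , b ⟩ , c ⟩ , d ⟩ ⨾ f ≈ ⟨ ⟨ ⟨ a , b ⟩ , c ⟩ , d ⟩ ⨾ g) → f ≈ g
  ext₄ p = ext₃ λ a b c →
    let q = ⟨⟩-cong (⟨⟩-cong ⟨⟩-η ≈-refl) ≈-refl in
    ≈-trans (⨾-congʳ q) (≈-trans (p (a ⨾ π₁) (a ⨾ π₂) b c) (≈-sym (⨾-congʳ q)))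

  ×α⇒ : ∀ {A B C} → (A ×₀ B) ×₀ C ⇒ A ×₀ (B ×₀ C)
  ×α⇒ = ⟨ π₁ ⨾ π₁ , ⟨ π₁ ⨾ π₂ , π₂ ⟩ ⟩

  ×α⇐ : ∀ {A B C} → A ×₀ (B ×₀ C) ⇒ (A ×₀ B) ×₀ C
  ×α⇐ = ⟨ ⟨ π₁ , π₂ ⨾ π₁ ⟩ , π₂ ⨾ π₂ ⟩

  ×σ : ∀ {A B} → A ×₀ B ⇒ B ×₀ A
  ×σ = ⟨ π₂ , π₁ ⟩

  ⟨⟩-α : ∀ {X A B C} {a : X ⇒ A} {b : X ⇒ B} {c : X ⇒ C} →
         ⟨ ⟨ a , b ⟩ , c ⟩ ⨾ ×α⇒ ≈ ⟨ a , ⟨ b , c ⟩ ⟩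
  ⟨⟩-α = ≈-trans ⨾-⟨⟩ (⟨⟩-cong (≈-trans (pull project₁) project₁)
           (≈-trans ⨾-⟨⟩ (⟨⟩-cong (≈-trans (pull project₁) project₂) project₂)))

  ⟨⟩-σ : ∀ {X A B} {a : X ⇒ A} {b : X ⇒ B} → ⟨ a , b ⟩ ⨾ ×σ ≈ ⟨ b , a ⟩
  ⟨⟩-σ = ≈-trans ⨾-⟨⟩ (⟨⟩-cong project₂ project₁)

  private
    ⟨⟩-α⇐ : ∀ {X A B C} {a : X ⇒ A} {b : X ⇒ B} {c : X ⇒ C} →
            ⟨ a , ⟨ b , c ⟩ ⟩ ⨾ ×α⇐ ≈ ⟨ ⟨ a , b ⟩ , c ⟩
    ⟨⟩-α⇐ = ≈-trans ⨾-⟨⟩ (⟨⟩-cong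
              (≈-trans ⨾-⟨⟩ (⟨⟩-cong project₁ (≈-trans (pull project₂) project₁)))
              (≈-trans (pull project₂) project₂))

  -- Defined by copatterns so that it does not unfold during conversion checking.
  symmetricMonoidal : SymmetricMonoidal C
  symmetricMonoidal .SymmetricMonoidal._⊗₀_ = _×₀_
  symmetricMonoidal .SymmetricMonoidal._⊗₁_ = _×₁_
  symmetricMonoidal .SymmetricMonoidal.unit = 𝟙
  symmetricMonoidal .SymmetricMonoidal.⊗-id = ≈-trans (⟨⟩-cong identityʳ identityʳ) ⟨π₁,π₂⟩≈id
  symmetricMonoidal .SymmetricMonoidal.⊗-⨾ = ≈-sym (≈-trans ⟨⟩-×₁ (⟨⟩-cong assoc assoc))
  symmetricMonoidal .SymmetricMonoidal.⊗-cong = λ p q → ⟨⟩-cong (⨾-congˡ p) (⨾-congˡ q)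
  symmetricMonoidal .SymmetricMonoidal.α⇒ = ×α⇒
  symmetricMonoidal .SymmetricMonoidal.λ⇒ = π₂
  symmetricMonoidal .SymmetricMonoidal.ρ⇒ = π₁
  symmetricMonoidal .SymmetricMonoidal.σ = ×σ
  symmetricMonoidal .SymmetricMonoidal.α-iso = record
      { inv  = ×α⇐
      ; isoˡ = ext₃ λ a b c → begin
          ⟨ ⟨ a , b ⟩ , c ⟩ ⨾ ×α⇒ ⨾ ×α⇐  ≈⟨ pull ⟨⟩-α ⟩
          ⟨ a , ⟨ b , c ⟩ ⟩ ⨾ ×α⇐        ≈⟨ ⟨⟩-α⇐ ⟩
          ⟨ ⟨ a , b ⟩ , c ⟩              ≈⟨ identityʳ ⟨
          ⟨ ⟨ a , b ⟩ , c ⟩ ⨾ id         ∎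
      ; isoʳ = ext₂ λ a b → begin
          ⟨ a , b ⟩ ⨾ ×α⇐ ⨾ ×α⇒                    ≈⟨ ⨾-congʳ (⟨⟩-cong ≈-refl ⟨⟩-η) ⟩
          ⟨ a , ⟨ b ⨾ π₁ , b ⨾ π₂ ⟩ ⟩ ⨾ ×α⇐ ⨾ ×α⇒  ≈⟨ pull ⟨⟩-α⇐ ⟩
          ⟨ ⟨ a , b ⨾ π₁ ⟩ , b ⨾ π₂ ⟩ ⨾ ×α⇒        ≈⟨ ⟨⟩-α ⟩
          ⟨ a , ⟨ b ⨾ π₁ , b ⨾ π₂ ⟩ ⟩              ≈⟨ ⟨⟩-cong ≈-refl ⟨⟩-η ⟨
          ⟨ a , b ⟩                                ≈⟨ identityʳ ⟨
          ⟨ a , b ⟩ ⨾ id                           ∎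
      }
  symmetricMonoidal .SymmetricMonoidal.λ-iso = record
      { inv  = ⟨ ⊤ , id ⟩
      ; isoˡ = ≈-trans ⨾-⟨⟩ (≈-sym (unique 𝟙-ext (≈-trans identityˡ (≈-sym identityʳ))))
      ; isoʳ = project₂
      }
  symmetricMonoidal .SymmetricMonoidal.ρ-iso = record
      { inv  = ⟨ id , ⊤ ⟩
      ; isoˡ = ≈-trans ⨾-⟨⟩ (≈-sym (unique (≈-trans identityˡ (≈-sym identityʳ)) 𝟙-ext))
      ; isoʳ = project₁
      }
  symmetricMonoidal .SymmetricMonoidal.α-natural = ext₃ λ a b c → begin
      ⟨ ⟨ a , b ⟩ , c ⟩ ⨾ _ ⨾ ×α⇒        ≈⟨ pull (≈-trans ⟨⟩-×₁ (⟨⟩-cong ⟨⟩-×₁ ≈-refl)) ⟩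
      ⟨ ⟨ a ⨾ _ , b ⨾ _ ⟩ , c ⨾ _ ⟩ ⨾ ×α⇒ ≈⟨ ⟨⟩-α ⟩
      ⟨ a ⨾ _ , ⟨ b ⨾ _ , c ⨾ _ ⟩ ⟩      ≈⟨ ≈-trans ⟨⟩-×₁ (⟨⟩-cong ≈-refl ⟨⟩-×₁) ⟨
      ⟨ a , ⟨ b , c ⟩ ⟩ ⨾ _              ≈⟨ pull ⟨⟩-α ⟨
      ⟨ ⟨ a , b ⟩ , c ⟩ ⨾ ×α⇒ ⨾ _        ∎
  symmetricMonoidal .SymmetricMonoidal.λ-natural = project₂
  symmetricMonoidal .SymmetricMonoidal.ρ-natural = project₁
  symmetricMonoidal .SymmetricMonoidal.σ-natural = ext₂ λ a b → begin
      ⟨ a , b ⟩ ⨾ _ ⨾ ×σ      ≈⟨ pull ⟨⟩-×₁ ⟩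
      ⟨ a ⨾ _ , b ⨾ _ ⟩ ⨾ ×σ  ≈⟨ ⟨⟩-σ ⟩
      ⟨ b ⨾ _ , a ⨾ _ ⟩       ≈⟨ ⟨⟩-×₁ ⟨
      ⟨ b , a ⟩ ⨾ _           ≈⟨ pull ⟨⟩-σ ⟨
      ⟨ a , b ⟩ ⨾ ×σ ⨾ _      ∎
  symmetricMonoidal .SymmetricMonoidal.triangle = ext₃ λ a b c → begin
      ⟨ ⟨ a , b ⟩ , c ⟩ ⨾ ×α⇒ ⨾ (id ×₁ π₂)  ≈⟨ pull ⟨⟩-α ⟩
      ⟨ a , ⟨ b , c ⟩ ⟩ ⨾ (id ×₁ π₂)        ≈⟨ ⟨⟩-×₁ ⟩
      ⟨ a ⨾ id , ⟨ b , c ⟩ ⨾ π₂ ⟩           ≈⟨ ⟨⟩-cong (≈-trans identityʳ (≈-sym project₁))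
                                                       (≈-trans project₂ (≈-sym identityʳ)) ⟩
      ⟨ ⟨ a , b ⟩ ⨾ π₁ , c ⨾ id ⟩           ≈⟨ ⟨⟩-×₁ ⟨
      ⟨ ⟨ a , b ⟩ , c ⟩ ⨾ (π₁ ×₁ id)        ∎
  symmetricMonoidal .SymmetricMonoidal.pentagon = ext₄ λ a b c d → begin
      ⟨ ⟨ ⟨ a , b ⟩ , c ⟩ , d ⟩ ⨾ (×α⇒ ×₁ id) ⨾ ×α⇒ ⨾ (id ×₁ ×α⇒)
        ≈⟨ pull (≈-trans ⟨⟩-×₁ (⟨⟩-cong ⟨⟩-α identityʳ)) ⟩
      ⟨ ⟨ a , ⟨ b , c ⟩ ⟩ , d ⟩ ⨾ ×α⇒ ⨾ (id ×₁ ×α⇒)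
        ≈⟨ pull ⟨⟩-α ⟩
      ⟨ a , ⟨ ⟨ b , c ⟩ , d ⟩ ⟩ ⨾ (id ×₁ ×α⇒)
        ≈⟨ ≈-trans ⟨⟩-×₁ (⟨⟩-cong identityʳ ⟨⟩-α) ⟩
      ⟨ a , ⟨ b , ⟨ c , d ⟩ ⟩ ⟩
        ≈⟨ ⟨⟩-α ⟨
      ⟨ ⟨ a , b ⟩ , ⟨ c , d ⟩ ⟩ ⨾ ×α⇒
        ≈⟨ pull ⟨⟩-α ⟨
      ⟨ ⟨ ⟨ a , b ⟩ , c ⟩ , d ⟩ ⨾ ×α⇒ ⨾ ×α⇒ ∎
  symmetricMonoidal .SymmetricMonoidal.σ-involutive = ext₂ λ a b → begin
      ⟨ a , b ⟩ ⨾ ×σ ⨾ ×σ  ≈⟨ pull ⟨⟩-σ ⟩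
      ⟨ b , a ⟩ ⨾ ×σ       ≈⟨ ⟨⟩-σ ⟩
      ⟨ a , b ⟩            ≈⟨ identityʳ ⟨
      ⟨ a , b ⟩ ⨾ id       ∎
  symmetricMonoidal .SymmetricMonoidal.hexagon = ext₃ λ a b c → begin
      ⟨ ⟨ a , b ⟩ , c ⟩ ⨾ ×α⇒ ⨾ ×σ ⨾ ×α⇒
        ≈⟨ pull ⟨⟩-α ⟩
      ⟨ a , ⟨ b , c ⟩ ⟩ ⨾ ×σ ⨾ ×α⇒
        ≈⟨ pull ⟨⟩-σ ⟩
      ⟨ ⟨ b , c ⟩ , a ⟩ ⨾ ×α⇒
        ≈⟨ ⟨⟩-α ⟩
      ⟨ b , ⟨ c , a ⟩ ⟩
        ≈⟨ ≈-trans ⟨⟩-×₁ (⟨⟩-cong identityʳ ⟨⟩-σ) ⟨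
      ⟨ b , ⟨ a , c ⟩ ⟩ ⨾ (id ×₁ ×σ)
        ≈⟨ pull ⟨⟩-α ⟨
      ⟨ ⟨ b , a ⟩ , c ⟩ ⨾ ×α⇒ ⨾ (id ×₁ ×σ)
        ≈⟨ pull (≈-trans ⟨⟩-×₁ (⟨⟩-cong ⟨⟩-σ identityʳ)) ⟨
      ⟨ ⟨ a , b ⟩ , c ⟩ ⨾ (×σ ×₁ id) ⨾ ×α⇒ ⨾ (id ×₁ ×σ) ∎

module Comonoid {o ℓ e o′ ℓ′ e′} {C : Category o ℓ e} {D : Category o′ ℓ′ e′}
    (P : Cartesian C) (N : SymmetricMonoidal D) {F : Functor C D}
    (S : StrongSymmetricMonoidal (Cartesian.symmetricMonoidal P) N F) where
  private
    module C = Category C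
    module P = Cartesian P
    module PM = SymmetricMonoidal P.symmetricMonoidal
  open Category D
  open SymmetricMonoidal N
  open Functor F
  open StrongSymmetricMonoidal S
  open HomReasoning

  c : ∀ {X} → F₀ X ⇒ F₀ X ⊗₀ F₀ X
  c = F₁ P.Δ ⨾ μ⁻¹

  w : ∀ {X} → F₀ X ⇒ unit
  w = F₁ P.⊤ ⨾ μ₀⁻¹

  F-merge : ∀ {X Y Z} {f : X C.⇒ Y} {g : Y C.⇒ Z} {h : X C.⇒ Z} →
            f C.⨾ g C.≈ h → F₁ f ⨾ F₁ g ≈ F₁ h
  F-merge p = ≈-trans (≈-sym F-⨾) (F-cong p)

  c-natural : ∀ {X Y} {f : X C.⇒ Y} → F₁ f ⨾ c ≈ c ⨾ (F₁ f ⊗₁ F₁ f)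
  c-natural {f = f} = begin
    F₁ f ⨾ F₁ P.Δ ⨾ μ⁻¹              ≈⟨ pull (F-merge p) ⟩
    F₁ (P.Δ C.⨾ (f P.×₁ f)) ⨾ μ⁻¹    ≈⟨ ⨾-congʳ F-⨾ ⟩
    (F₁ P.Δ ⨾ F₁ (f P.×₁ f)) ⨾ μ⁻¹   ≈⟨ assoc ⟩
    F₁ P.Δ ⨾ F₁ (f P.×₁ f) ⨾ μ⁻¹     ≈⟨ ⨾-congˡ μ⁻¹-natural ⟩
    F₁ P.Δ ⨾ μ⁻¹ ⨾ (F₁ f ⊗₁ F₁ f)    ≈⟨ assoc ⟨
    c ⨾ (F₁ f ⊗₁ F₁ f)               ∎
    where
      p : f C.⨾ P.Δ C.≈ P.Δ C.⨾ (f P.×₁ f)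
      p = C.≈-trans P.⨾-⟨⟩ (C.≈-trans
            (P.⟨⟩-cong (C.≈-trans C.identityʳ (C.≈-sym C.identityˡ))
                       (C.≈-trans C.identityʳ (C.≈-sym C.identityˡ)))
            (C.≈-sym P.⟨⟩-×₁))

  w-natural : ∀ {X Y} {f : X C.⇒ Y} → F₁ f ⨾ w ≈ w
  w-natural = pull (F-merge P.⊤-unique)

  c-w-unitˡ : ∀ {X} → c {X} ⨾ (w ⊗₁ id) ⨾ λ⇒ ≈ id
  c-w-unitˡ = begin
    (F₁ P.Δ ⨾ μ⁻¹) ⨾ (w ⊗₁ id) ⨾ λ⇒
      ≈⟨ assoc ⟩
    F₁ P.Δ ⨾ μ⁻¹ ⨾ (w ⊗₁ id) ⨾ λ⇒
      ≈⟨ ⨾-congˡ (⨾-congˡ (pull (⊗-merge ≈-refl (≈-trans (⨾-congʳ F-id) identityˡ)))) ⟨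
    F₁ P.Δ ⨾ μ⁻¹ ⨾ (F₁ P.⊤ ⊗₁ F₁ C.id) ⨾ (μ₀⁻¹ ⊗₁ id) ⨾ λ⇒
      ≈⟨ ⨾-congˡ (swap μ⁻¹-natural) ⟨
    F₁ P.Δ ⨾ F₁ (P.⊤ P.×₁ C.id) ⨾ μ⁻¹ ⨾ (μ₀⁻¹ ⊗₁ id) ⨾ λ⇒
      ≈⟨ ⨾-congˡ (⨾-congˡ μ⁻¹-unitˡ) ⟩
    F₁ P.Δ ⨾ F₁ (P.⊤ P.×₁ C.id) ⨾ F₁ P.π₂
      ≈⟨ pull (F-merge P.⟨⟩-×₁) ⟩
    F₁ P.⟨ _ , _ ⟩ ⨾ F₁ P.π₂
      ≈⟨ F-merge (C.≈-trans P.project₂ C.identityˡ) ⟩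
    F₁ C.id
      ≈⟨ F-id ⟩
    id ∎

  c-w-unitʳ : ∀ {X} → c {X} ⨾ (id ⊗₁ w) ⨾ ρ⇒ ≈ id
  c-w-unitʳ = begin
    (F₁ P.Δ ⨾ μ⁻¹) ⨾ (id ⊗₁ w) ⨾ ρ⇒
      ≈⟨ assoc ⟩
    F₁ P.Δ ⨾ μ⁻¹ ⨾ (id ⊗₁ w) ⨾ ρ⇒
      ≈⟨ ⨾-congˡ (⨾-congˡ (pull (⊗-merge (≈-trans (⨾-congʳ F-id) identityˡ) ≈-refl))) ⟨
    F₁ P.Δ ⨾ μ⁻¹ ⨾ (F₁ C.id ⊗₁ F₁ P.⊤) ⨾ (id ⊗₁ μ₀⁻¹) ⨾ ρ⇒
      ≈⟨ ⨾-congˡ (swap μ⁻¹-natural) ⟨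
    F₁ P.Δ ⨾ F₁ (C.id P.×₁ P.⊤) ⨾ μ⁻¹ ⨾ (id ⊗₁ μ₀⁻¹) ⨾ ρ⇒
      ≈⟨ ⨾-congˡ (⨾-congˡ μ⁻¹-unitʳ) ⟩
    F₁ P.Δ ⨾ F₁ (C.id P.×₁ P.⊤) ⨾ F₁ P.π₁
      ≈⟨ pull (F-merge P.⟨⟩-×₁) ⟩
    F₁ P.⟨ _ , _ ⟩ ⨾ F₁ P.π₁
      ≈⟨ F-merge (C.≈-trans P.project₁ C.identityˡ) ⟩
    F₁ C.id
      ≈⟨ F-id ⟩
    id ∎

  c-coassoc : ∀ {X} → c {X} ⨾ (c ⊗₁ id) ⨾ α⇒ ≈ c ⨾ (id ⊗₁ c)
  c-coassoc = begin
    (F₁ P.Δ ⨾ μ⁻¹) ⨾ (c ⊗₁ id) ⨾ α⇒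
      ≈⟨ assoc ⟩
    F₁ P.Δ ⨾ μ⁻¹ ⨾ (c ⊗₁ id) ⨾ α⇒
      ≈⟨ ⨾-congˡ (⨾-congˡ (pull (⊗-merge ≈-refl (≈-trans (⨾-congʳ F-id) identityˡ)))) ⟨
    F₁ P.Δ ⨾ μ⁻¹ ⨾ (F₁ P.Δ ⊗₁ F₁ C.id) ⨾ (μ⁻¹ ⊗₁ id) ⨾ α⇒
      ≈⟨ ⨾-congˡ (swap μ⁻¹-natural) ⟨
    F₁ P.Δ ⨾ F₁ (P.Δ P.×₁ C.id) ⨾ μ⁻¹ ⨾ (μ⁻¹ ⊗₁ id) ⨾ α⇒
      ≈⟨ ⨾-congˡ (⨾-congˡ μ⁻¹-assoc) ⟩
    F₁ P.Δ ⨾ F₁ (P.Δ P.×₁ C.id) ⨾ F₁ P.×α⇒ ⨾ μ⁻¹ ⨾ (id ⊗₁ μ⁻¹)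
      ≈⟨ pull (F-merge ≈Δ) ⟩
    F₁ P.⟨ P.Δ , C.id ⟩ ⨾ F₁ P.×α⇒ ⨾ μ⁻¹ ⨾ (id ⊗₁ μ⁻¹)
      ≈⟨ pull (F-merge P.⟨⟩-α) ⟩
    F₁ P.⟨ C.id , P.Δ ⟩ ⨾ μ⁻¹ ⨾ (id ⊗₁ μ⁻¹)
      ≈⟨ pull (F-merge Δ≈) ⟨
    F₁ P.Δ ⨾ F₁ (C.id P.×₁ P.Δ) ⨾ μ⁻¹ ⨾ (id ⊗₁ μ⁻¹)
      ≈⟨ ⨾-congˡ (swap μ⁻¹-natural) ⟩
    F₁ P.Δ ⨾ μ⁻¹ ⨾ (F₁ C.id ⊗₁ F₁ P.Δ) ⨾ (id ⊗₁ μ⁻¹)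
      ≈⟨ ⨾-congˡ (⨾-congˡ (⊗-merge (≈-trans (⨾-congʳ F-id) identityˡ) ≈-refl)) ⟩
    F₁ P.Δ ⨾ μ⁻¹ ⨾ (id ⊗₁ c)
      ≈⟨ assoc ⟨
    c ⨾ (id ⊗₁ c) ∎
    where
      ≈Δ : ∀ {X} → P.Δ {X} C.⨾ (P.Δ P.×₁ C.id) C.≈ P.⟨ P.Δ , C.id ⟩
      ≈Δ = C.≈-trans P.⟨⟩-×₁ (P.⟨⟩-cong C.identityˡ C.identityˡ)
      Δ≈ : ∀ {X} → P.Δ {X} C.⨾ (C.id P.×₁ P.Δ) C.≈ P.⟨ C.id , P.Δ ⟩
      Δ≈ = C.≈-trans P.⟨⟩-×₁ (P.⟨⟩-cong C.identityˡ C.identityˡ)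

  c-cocomm : ∀ {X} → c {X} ⨾ σ ≈ c
  c-cocomm = begin
    (F₁ P.Δ ⨾ μ⁻¹) ⨾ σ      ≈⟨ assoc ⟩
    F₁ P.Δ ⨾ μ⁻¹ ⨾ σ        ≈⟨ ⨾-congˡ μ⁻¹-sym ⟩
    F₁ P.Δ ⨾ F₁ P.×σ ⨾ μ⁻¹  ≈⟨ pull (F-merge P.⟨⟩-σ) ⟩
    F₁ P.Δ ⨾ μ⁻¹            ∎

record LNL {o ℓ e o′ ℓ′ e′} {C : Category o ℓ e} (P : Cartesian C)
    {L : Category o′ ℓ′ e′} (M : SymmetricMonoidal L)
    : Set (o ⊔ ℓ ⊔ e ⊔ o′ ⊔ ℓ′ ⊔ e′) where
  private
    module C = Category C
    module P = Cartesian P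
    module L = Category L
    module M = SymmetricMonoidal M
  field
    F : Functor C L
    U : Functor L C
    F-strong : StrongSymmetricMonoidal P.symmetricMonoidal M F
    U-lax    : LaxSymmetricMonoidal M P.symmetricMonoidal U
    unit     : NaturalTransformation idF (F ⨾F U)
    counit   : NaturalTransformation (U ⨾F F) idF

  open Functor F public
  open Functor U public
    renaming (F₀ to U₀; F₁ to U₁; F-id to U-id; F-⨾ to U-⨾; F-cong to U-cong)
  open StrongSymmetricMonoidal F-strong public using ()
    renaming (μ to m; μ⁻¹ to m⁻¹; μ₀ to m₁; μ₀⁻¹ to m₁⁻¹)
  open LaxSymmetricMonoidal U-lax public using ()
    renaming (μ to n; μ₀ to n₁)
  open NaturalTransformation unit public
    renaming (at to η; natural to η-natural)
  open NaturalTransformation counit public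
    renaming (at to ε; natural to ε-natural)
  open Comonoid P M F-strong public

  field
    zig : ∀ {X} → F₁ (η X) L.⨾ ε (F₀ X) L.≈ L.id
    zag : ∀ {A} → η (U₀ A) C.⨾ U₁ (ε A) C.≈ C.id

    η-monoidal  : ∀ {X Y} → (η X P.×₁ η Y) C.⨾ n C.⨾ U₁ m C.≈ η (X P.×₀ Y)
    η-monoidal₁ : n₁ C.⨾ U₁ m₁ C.≈ η P.𝟙
    ε-monoidal  : ∀ {A B} → m L.⨾ F₁ n L.⨾ ε (A M.⊗₀ B) L.≈ ε A M.⊗₁ ε B
    ε-monoidal₁ : m₁ L.⨾ F₁ n₁ L.⨾ ε M.unit L.≈ L.id

module LinearSimple {o ℓ e o′ ℓ′ e′} {C : Category o ℓ e} {P : Cartesian C}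
    {L : Category o′ ℓ′ e′} {M : SymmetricMonoidal L} (lnl : LNL P M) where
  private
    module C = Category C
    module P = Cartesian P
  open Category L
  open SymmetricMonoidal M
  open LNL lnl using (F₀; F₁; F-id; F-⨾; F-cong; c; w; c-natural; w-natural;
                      c-w-unitˡ; c-w-unitʳ; c-coassoc)
  open HomReasoning

  record LS⇒ (XA YB : C.Obj × Obj) : Set (ℓ ⊔ ℓ′) where
    constructor ⟪_,_⟫
    field
      base  : proj₁ XA C.⇒ proj₁ YB
      fibre : F₀ (proj₁ XA) ⊗₀ proj₂ XA ⇒ proj₂ YB
  open LS⇒ public

  -- w_X ⊗ u, read as a morphism F X ⊗ A ⇒ B through the unitor.
  w⊗ : ∀ {X A B} → A ⇒ B → F₀ X ⊗₀ A ⇒ B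
  w⊗ u = (w ⊗₁ u) ⨾ λ⇒

  -- (c_X ⊗ id) ; (F f ⊗ u) ; v, with the associator made explicit.
  comp : ∀ {X Y A B D} → (X C.⇒ Y) → (F₀ X ⊗₀ A ⇒ B) → (F₀ Y ⊗₀ B ⇒ D) → F₀ X ⊗₀ A ⇒ D
  comp f u v = (c ⊗₁ id) ⨾ α⇒ ⨾ (F₁ f ⊗₁ u) ⨾ v

  comp-w⊗ : ∀ {X Y A B D} {f : X C.⇒ Y} {u : F₀ X ⊗₀ A ⇒ B} {v : B ⇒ D} →
            comp f u (w⊗ v) ≈ u ⨾ v
  comp-w⊗ {f = f} {u} {v} = begin
    (c ⊗₁ id) ⨾ α⇒ ⨾ (F₁ f ⊗₁ u) ⨾ (w ⊗₁ v) ⨾ λ⇒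
      ≈⟨ ⨾-congˡ (⨾-congˡ (pull (⊗-merge (≈-trans w-natural (≈-sym identityʳ)) (≈-sym identityˡ)))) ⟩
    (c ⊗₁ id) ⨾ α⇒ ⨾ ((w ⨾ id) ⊗₁ (id ⨾ (u ⨾ v))) ⨾ λ⇒
      ≈⟨ ⨾-congˡ (⨾-congˡ (≈-trans (⨾-congʳ ⊗-⨾) (≈-trans assoc (⨾-congˡ λ-natural)))) ⟩
    (c ⊗₁ id) ⨾ α⇒ ⨾ (w ⊗₁ id) ⨾ λ⇒ ⨾ (u ⨾ v)
      ≈⟨ ⨾-congˡ (⨾-congˡ (⨾-congʳ (⊗-congˡ ⊗-id))) ⟨
    (c ⊗₁ id) ⨾ α⇒ ⨾ (w ⊗₁ (id ⊗₁ id)) ⨾ λ⇒ ⨾ (u ⨾ v)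
      ≈⟨ ⨾-congˡ (swap α-natural) ⟨
    (c ⊗₁ id) ⨾ ((w ⊗₁ id) ⊗₁ id) ⨾ α⇒ ⨾ λ⇒ ⨾ (u ⨾ v)
      ≈⟨ ⨾-congˡ (⨾-congˡ (pull λ-coherence)) ⟩
    (c ⊗₁ id) ⨾ ((w ⊗₁ id) ⊗₁ id) ⨾ (λ⇒ ⊗₁ id) ⨾ (u ⨾ v)
      ≈⟨ ⨾-congˡ (pull (⊗-merge ≈-refl identityˡ)) ⟩
    (c ⊗₁ id) ⨾ (((w ⊗₁ id) ⨾ λ⇒) ⊗₁ id) ⨾ (u ⨾ v)
      ≈⟨ cancel (≈-trans (⊗-merge c-w-unitˡ identityˡ) ⊗-id) ⟩
    u ⨾ v ∎

  LS : Category (o ⊔ o′) (ℓ ⊔ ℓ′) (e ⊔ e′)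
  LS = record
    { Obj = C.Obj × Obj
    ; _⇒_ = LS⇒
    ; _≈_ = λ f g → (base f C.≈ base g) × (fibre f ≈ fibre g)
    ; id  = ⟪ C.id , w⊗ id ⟫
    ; _⨾_ = λ f g → ⟪ base f C.⨾ base g , comp (base f) (fibre f) (fibre g) ⟫
    ; equiv = record
        { refl  = C.≈-refl , ≈-refl
        ; sym   = λ (p , q) → C.≈-sym p , ≈-sym q
        ; trans = λ (p , q) (p′ , q′) → C.≈-trans p p′ , ≈-trans q q′
        }
    ; assoc     = C.assoc , comp-assoc
    ; identityˡ = C.identityˡ , comp-idˡ
    ; identityʳ = C.identityʳ , ≈-trans comp-w⊗ identityʳ
    ; ⨾-cong    = λ (p , q) (p′ , q′) →
        C.⨾-cong p p′ , ⨾-congˡ (⨾-congˡ (⨾-cong (⊗-cong (F-cong p) q) q′))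
    }
    where
      comp-idˡ : ∀ {X A B} {u : F₀ X ⊗₀ A ⇒ B} → comp C.id (w⊗ id) u ≈ u
      comp-idˡ {u = u} = begin
        (c ⊗₁ id) ⨾ α⇒ ⨾ (F₁ C.id ⊗₁ ((w ⊗₁ id) ⨾ λ⇒)) ⨾ u
          ≈⟨ ⨾-congˡ (⨾-congˡ (≈-trans
               (⨾-congʳ (≈-trans (⊗-congʳ (≈-trans F-id (≈-sym identityˡ))) ⊗-⨾)) assoc)) ⟩
        (c ⊗₁ id) ⨾ α⇒ ⨾ (id ⊗₁ (w ⊗₁ id)) ⨾ (id ⊗₁ λ⇒) ⨾ u
          ≈⟨ ⨾-congˡ (swap α-natural) ⟨
        (c ⊗₁ id) ⨾ ((id ⊗₁ w) ⊗₁ id) ⨾ α⇒ ⨾ (id ⊗₁ λ⇒) ⨾ u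
          ≈⟨ ⨾-congˡ (⨾-congˡ (pull triangle)) ⟩
        (c ⊗₁ id) ⨾ ((id ⊗₁ w) ⊗₁ id) ⨾ (ρ⇒ ⊗₁ id) ⨾ u
          ≈⟨ ⨾-congˡ (pull (⊗-merge ≈-refl identityˡ)) ⟩
        (c ⊗₁ id) ⨾ (((id ⊗₁ w) ⨾ ρ⇒) ⊗₁ id) ⨾ u
          ≈⟨ cancel (≈-trans (⊗-merge c-w-unitʳ identityˡ) ⊗-id) ⟩
        u ∎

      c-c : ∀ {X A} → (c {X} ⊗₁ id {A}) ⨾ α⇒ ⨾ (c ⊗₁ id) ⨾ α⇒ ≈
                      (c ⊗₁ id) ⨾ α⇒ ⨾ (id ⊗₁ ((c ⊗₁ id) ⨾ α⇒))
      c-c = begin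
        (c ⊗₁ id) ⨾ α⇒ ⨾ (c ⊗₁ id) ⨾ α⇒
          ≈⟨ ⨾-congˡ (⨾-congˡ (⨾-congʳ (⊗-congˡ ⊗-id))) ⟨
        (c ⊗₁ id) ⨾ α⇒ ⨾ (c ⊗₁ (id ⊗₁ id)) ⨾ α⇒
          ≈⟨ ⨾-congˡ (swap α-natural) ⟨
        (c ⊗₁ id) ⨾ ((c ⊗₁ id) ⊗₁ id) ⨾ α⇒ ⨾ α⇒
          ≈⟨ ⨾-congˡ (⨾-congˡ pentagon) ⟨
        (c ⊗₁ id) ⨾ ((c ⊗₁ id) ⊗₁ id) ⨾ (α⇒ ⊗₁ id) ⨾ α⇒ ⨾ (id ⊗₁ α⇒)
          ≈⟨ ⨾-congˡ (pull (⊗-merge ≈-refl identityˡ)) ⟩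
        (c ⊗₁ id) ⨾ (((c ⊗₁ id) ⨾ α⇒) ⊗₁ id) ⨾ α⇒ ⨾ (id ⊗₁ α⇒)
          ≈⟨ swap (≈-trans (⊗-merge c-coassoc ≈-refl) ⊗-⨾) ⟩
        (c ⊗₁ id) ⨾ ((id ⊗₁ c) ⊗₁ id) ⨾ α⇒ ⨾ (id ⊗₁ α⇒)
          ≈⟨ ⨾-congˡ (swap α-natural) ⟩
        (c ⊗₁ id) ⨾ α⇒ ⨾ (id ⊗₁ (c ⊗₁ id)) ⨾ (id ⊗₁ α⇒)
          ≈⟨ ⨾-congˡ (⨾-congˡ (⊗-merge identityˡ ≈-refl)) ⟩
        (c ⊗₁ id) ⨾ α⇒ ⨾ (id ⊗₁ ((c ⊗₁ id) ⨾ α⇒)) ∎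

      comp-assoc : ∀ {X Y Z A B D E} {f : X C.⇒ Y} {g : Y C.⇒ Z}
                     {u : F₀ X ⊗₀ A ⇒ B} {v : F₀ Y ⊗₀ B ⇒ D} {z : F₀ Z ⊗₀ D ⇒ E} →
                   comp (f C.⨾ g) (comp f u v) z ≈ comp f u (comp g v z)
      comp-assoc {f = f} {g} {u} {v} {z} = begin
        (c ⊗₁ id) ⨾ α⇒ ⨾ (F₁ (f C.⨾ g) ⊗₁ comp f u v) ⨾ z
          ≈⟨ ⨾-congˡ (⨾-congˡ (pull (⊗-merge identityˡ assoc³))) ⟨
        (c ⊗₁ id) ⨾ α⇒ ⨾ (id ⊗₁ ((c ⊗₁ id) ⨾ α⇒)) ⨾ (F₁ (f C.⨾ g) ⊗₁ ((F₁ f ⊗₁ u) ⨾ v)) ⨾ z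
          ≈⟨ reassoc ⟩
        ((c ⊗₁ id) ⨾ α⇒ ⨾ (id ⊗₁ ((c ⊗₁ id) ⨾ α⇒))) ⨾ (F₁ (f C.⨾ g) ⊗₁ ((F₁ f ⊗₁ u) ⨾ v)) ⨾ z
          ≈⟨ ⨾-congʳ c-c ⟨
        ((c ⊗₁ id) ⨾ α⇒ ⨾ (c ⊗₁ id) ⨾ α⇒) ⨾ (F₁ (f C.⨾ g) ⊗₁ ((F₁ f ⊗₁ u) ⨾ v)) ⨾ z
          ≈⟨ ≈-trans (⨾-congˡ (⨾-congˡ (≈-sym assoc))) reassoc ⟨
        (c ⊗₁ id) ⨾ α⇒ ⨾ (c ⊗₁ id) ⨾ α⇒ ⨾ (F₁ (f C.⨾ g) ⊗₁ ((F₁ f ⊗₁ u) ⨾ v)) ⨾ z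
          ≈⟨ ⨾-congˡ (⨾-congˡ (⨾-congˡ (⨾-congˡ (pull (⊗-merge (≈-sym F-⨾) ≈-refl))))) ⟨
        (c ⊗₁ id) ⨾ α⇒ ⨾ (c ⊗₁ id) ⨾ α⇒ ⨾ (F₁ f ⊗₁ (F₁ f ⊗₁ u)) ⨾ (F₁ g ⊗₁ v) ⨾ z
          ≈⟨ ⨾-congˡ (⨾-congˡ (⨾-congˡ (swap α-natural))) ⟨
        (c ⊗₁ id) ⨾ α⇒ ⨾ (c ⊗₁ id) ⨾ ((F₁ f ⊗₁ F₁ f) ⊗₁ u) ⨾ α⇒ ⨾ (F₁ g ⊗₁ v) ⨾ z
          ≈⟨ ⨾-congˡ (⨾-congˡ (swap (≈-trans (⊗-merge c-natural (≈-trans identityʳ (≈-sym identityˡ))) ⊗-⨾))) ⟨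
        (c ⊗₁ id) ⨾ α⇒ ⨾ (F₁ f ⊗₁ u) ⨾ (c ⊗₁ id) ⨾ α⇒ ⨾ (F₁ g ⊗₁ v) ⨾ z ∎
        where
          assoc³ : ((c ⊗₁ id) ⨾ α⇒) ⨾ (F₁ f ⊗₁ u) ⨾ v ≈ comp f u v
          assoc³ = assoc
          reassoc : ∀ {A B C D E} {h : A ⇒ B} {i : B ⇒ C} {j : C ⇒ D} {k : D ⇒ E} →
                    h ⨾ i ⨾ j ⨾ k ≈ (h ⨾ i ⨾ j) ⨾ k
          reassoc = ≈-sym (≈-trans assoc (⨾-congˡ assoc))

  ls : Functor LS C
  ls = record
    { F₀ = proj₁ ; F₁ = base
    ; F-id = C.≈-refl ; F-⨾ = C.≈-refl ; F-cong = proj₁ }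

  LS-cartesian : Cartesian L → Cartesian LS
  LS-cartesian Q = record
    { 𝟙        = P.𝟙 , Q.𝟙
    ; ⊤        = ⟪ P.⊤ , Q.⊤ ⟫
    ; ⊤-unique = P.⊤-unique , Q.⊤-unique
    ; _×₀_     = λ (X , A) (Y , B) → X P.×₀ Y , A Q.×₀ B
    ; π₁       = ⟪ P.π₁ , w⊗ Q.π₁ ⟫
    ; π₂       = ⟪ P.π₂ , w⊗ Q.π₂ ⟫
    ; ⟨_,_⟩    = λ f g → ⟪ P.⟨ base f , base g ⟩ , Q.⟨ fibre f , fibre g ⟩ ⟫
    ; project₁ = P.project₁ , ≈-trans comp-w⊗ Q.project₁
    ; project₂ = P.project₂ , ≈-trans comp-w⊗ Q.project₂
    ; unique   = λ (p , q) (p′ , q′) →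
        P.unique p p′ , Q.unique (≈-trans (≈-sym comp-w⊗) q) (≈-trans (≈-sym comp-w⊗) q′)
    }
    where module Q = Cartesian Q

record Additive {o ℓ e} {L : Category o ℓ e} (M : SymmetricMonoidal L) : Set (o ⊔ ℓ ⊔ e) where
  open Category L
  open SymmetricMonoidal M
  infixl 6 _+_
  field
    _+_ : ∀ {A B} → A ⇒ B → A ⇒ B → A ⇒ B
    0#  : ∀ {A B} → A ⇒ B
    +-isCommutativeMonoid : ∀ {A B} → IsCommutativeMonoid (_≈_ {A} {B}) _+_ 0#

    ⨾-distribʳ : ∀ {A B C} {f g : A ⇒ B} {h : B ⇒ C} → (f + g) ⨾ h ≈ f ⨾ h + g ⨾ h
    ⨾-distribˡ : ∀ {A B C} {f : A ⇒ B} {g h : B ⇒ C} → f ⨾ (g + h) ≈ f ⨾ g + f ⨾ h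
    ⨾-zeroˡ    : ∀ {A B C} {h : B ⇒ C} → 0# {A} {B} ⨾ h ≈ 0#
    ⨾-zeroʳ    : ∀ {A B C} {f : A ⇒ B} → f ⨾ 0# {B} {C} ≈ 0#
    ⊗-distribʳ : ∀ {A B A′ B′} {f g : A ⇒ B} {h : A′ ⇒ B′} → (f + g) ⊗₁ h ≈ f ⊗₁ h + g ⊗₁ h
    ⊗-distribˡ : ∀ {A B A′ B′} {f : A ⇒ B} {g h : A′ ⇒ B′} → f ⊗₁ (g + h) ≈ f ⊗₁ g + f ⊗₁ h
    ⊗-zeroˡ    : ∀ {A B A′ B′} {h : A′ ⇒ B′} → 0# {A} {B} ⊗₁ h ≈ 0#
    ⊗-zeroʳ    : ∀ {A B A′ B′} {f : A ⇒ B} → f ⊗₁ 0# {A′} {B′} ≈ 0#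

-- Over an additive category finite products are automatically biproducts, so
-- the injections are defined rather than assumed.
module Biproducts {o ℓ e} {L : Category o ℓ e} {M : SymmetricMonoidal L}
    (A : Additive M) (Q : Cartesian L) where
  open Category L
  open Additive A
  open Cartesian Q
  private
    open module +-monoid {A B : Obj} = IsCommutativeMonoid (+-isCommutativeMonoid {A} {B})
      using () renaming (identityˡ to +-identityˡ; identityʳ to +-identityʳ; ∙-cong to +-cong)

  ι₁ : ∀ {A B} → A ⇒ A ×₀ B
  ι₁ = ⟨ id , 0# ⟩

  ι₂ : ∀ {A B} → B ⇒ A ×₀ B
  ι₂ = ⟨ 0# , id ⟩

  ι₁⨾π₁ : ∀ {A B} → ι₁ {A} {B} ⨾ π₁ ≈ id
  ι₁⨾π₁ = project₁

  ι₁⨾π₂ : ∀ {A B} → ι₁ {A} {B} ⨾ π₂ ≈ 0#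
  ι₁⨾π₂ = project₂

  ι₂⨾π₁ : ∀ {A B} → ι₂ {A} {B} ⨾ π₁ ≈ 0#
  ι₂⨾π₁ = project₁

  ι₂⨾π₂ : ∀ {A B} → ι₂ {A} {B} ⨾ π₂ ≈ id
  ι₂⨾π₂ = project₂

  π⨾ι-sum : ∀ {A B} → π₁ ⨾ ι₁ + π₂ ⨾ ι₂ ≈ id {A ×₀ B}
  π⨾ι-sum = ≈-trans (unique
      (≈-trans ⨾-distribʳ (≈-trans (+-cong (part identityʳ project₁) (part ⨾-zeroʳ project₁)) (+-identityʳ _)))
      (≈-trans ⨾-distribʳ (≈-trans (+-cong (part ⨾-zeroʳ project₂) (part identityʳ project₂)) (+-identityˡ _))))
    ⟨π₁,π₂⟩≈id
    where
      part : ∀ {A B C D} {f : A ⇒ B} {i : B ⇒ C} {p : C ⇒ D} {j : B ⇒ D} {k : A ⇒ D} →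
             f ⨾ j ≈ k → i ⨾ p ≈ j → (f ⨾ i) ⨾ p ≈ k
      part q r = ≈-trans assoc (≈-trans (⨾-congˡ r) q)

record GeneralisedDifferential {o ℓ e o′ ℓ′ e′} {C : Category o ℓ e} {P : Cartesian C}
    {L : Category o′ ℓ′ e′} {M : SymmetricMonoidal L}
    (lnl : LNL P M) (add : Additive M) (Q : Cartesian L)
    : Set (o ⊔ ℓ ⊔ e ⊔ o′ ⊔ ℓ′ ⊔ e′) where
  private
    module C = Category C
    module P = Cartesian P
    module L = Category L
    module M = SymmetricMonoidal M
    module Q = Cartesian Q
  open LNL lnl using (F₀; F₁; U₀; U₁; n; η)
  open Biproducts add Q using (ι₂)
  open LinearSimple lnl
  open Category LS
  open Cartesian (LS-cartesian Q) using (⟨_,_⟩)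

  field
    𝒯 : Functor C LS
  open Functor 𝒯 public using () renaming (F₀ to 𝒯₀; F₁ to 𝒯₁)

  field
    ls∘𝒯 : (𝒯 ⨾F ls) ≡F idF

  lin : C.Obj → L.Obj
  lin X = proj₂ (𝒯₀ X)

  𝒯₀≡ : ∀ X → 𝒯₀ X ≡ (X , lin X)
  𝒯₀≡ X = cong (_, lin X) (_≡F_.obj≡ ls∘𝒯 X)

  -- The pairing lands in 𝒯₀ X × 𝒯₀ Y, which ls∘𝒯 identifies with the
  -- displayed codomain.
  φ : ∀ X Y → 𝒯₀ (X P.×₀ Y) ⇒ (X P.×₀ Y , lin X Q.×₀ lin Y)
  φ X Y = ⟨ 𝒯₁ P.π₁ , 𝒯₁ P.π₂ ⟩ ⨾
          cast (cong (λ Z → Z , lin X Q.×₀ lin Y)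
                     (cong₂ P._×₀_ (_≡F_.obj≡ ls∘𝒯 X) (_≡F_.obj≡ ls∘𝒯 Y)))

  field
    φ-iso : ∀ X Y → IsIso (φ X Y)
    𝒯∘U   : ∀ A → 𝒯₀ (U₀ A) ≡ (U₀ A , A)

  i₂ : ∀ X Y → (X P.×₀ Y , lin Y) ⇒ 𝒯₀ (X P.×₀ Y)
  i₂ X Y = ⟪ C.id , w⊗ ι₂ ⟫ ⨾ IsIso.inv (φ-iso X Y)

  -- i₂ for Y = U A, with lin (U A) identified with A.
  i₂U : ∀ X A → (X P.×₀ U₀ A , A) ⇒ 𝒯₀ (X P.×₀ U₀ A)
  i₂U X A = cast (cong (X P.×₀ U₀ A ,_) (sym (cong proj₂ (𝒯∘U A)))) ⨾ i₂ X (U₀ A)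

  ⦃|_|⦄ : ∀ {X A Y B} → (X , A) ⇒ (Y , B) → X P.×₀ U₀ A C.⇒ Y P.×₀ U₀ B
  ⦃|_|⦄ {X} h = P.⟨ P.π₁ C.⨾ base h , (η X P.×₁ C.id) C.⨾ n C.⨾ U₁ (fibre h) ⟩

  W : ∀ {X A Y B} → (X , A) ⇒ (Y , B) → (X P.×₀ U₀ A , A) ⇒ (Y P.×₀ U₀ B , B)
  W h = ⟪ ⦃| h |⦄ , (F₁ P.π₁ M.⊗₁ L.id) L.⨾ fibre h ⟫

  field
    W-i₂ : ∀ {X A Y B} (h : (X , A) ⇒ (Y , B)) →
           W h ⨾ i₂U Y B ≈ i₂U X A ⨾ 𝒯₁ ⦃| h |⦄

record Comonad {o ℓ e} (L : Category o ℓ e) : Set (o ⊔ ℓ ⊔ e) where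
  open Category L
  field
    !      : Functor L L
    counit : NaturalTransformation ! idF
    comult : NaturalTransformation ! (! ⨾F !)
  open Functor ! public
    renaming (F₀ to !₀; F₁ to !₁; F-id to !-id; F-⨾ to !-⨾; F-cong to !-cong)
  open NaturalTransformation counit public renaming (at to d; natural to d-natural)
  open NaturalTransformation comult public renaming (at to p; natural to p-natural)
  field
    p-dˡ    : ∀ {A} → p A ⨾ d (!₀ A) ≈ id
    p-dʳ    : ∀ {A} → p A ⨾ !₁ (d A) ≈ id
    p-assoc : ∀ {A} → p A ⨾ p (!₀ A) ≈ p A ⨾ !₁ (p A)

module CoKleisli {o ℓ e} {L : Category o ℓ e} (W : Comonad L) where
  open Category L
  open Comonad W
  open HomReasoning

  L! : Category o ℓ e
  L! = record
    { Obj = Obj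
    ; _⇒_ = λ A B → !₀ A ⇒ B
    ; _≈_ = _≈_
    ; id  = d _
    ; _⨾_ = λ f g → p _ ⨾ !₁ f ⨾ g
    ; equiv = equiv
    ; assoc = λ {_} {_} {_} {_} {f} {g} {h} → begin
        p _ ⨾ !₁ (p _ ⨾ !₁ f ⨾ g) ⨾ h
          ≈⟨ ⨾-congˡ (⨾-congʳ (≈-trans !-⨾ (⨾-congˡ !-⨾))) ⟩
        p _ ⨾ (!₁ (p _) ⨾ !₁ (!₁ f) ⨾ !₁ g) ⨾ h
          ≈⟨ ⨾-congˡ (≈-trans assoc (⨾-congˡ assoc)) ⟩
        p _ ⨾ !₁ (p _) ⨾ !₁ (!₁ f) ⨾ !₁ g ⨾ h
          ≈⟨ swap p-assoc ⟨
        p _ ⨾ p _ ⨾ !₁ (!₁ f) ⨾ !₁ g ⨾ h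
          ≈⟨ ⨾-congˡ (swap (p-natural f)) ⟨
        p _ ⨾ !₁ f ⨾ p _ ⨾ !₁ g ⨾ h ∎
    ; identityˡ = cancel p-dʳ
    ; identityʳ = λ {_} {_} {f} → ≈-trans (⨾-congˡ (d-natural f)) (cancel p-dˡ)
    ; ⨾-cong    = λ q r → ⨾-congˡ (⨾-cong (!-cong q) r)
    }

  private module K = Category L!

  F! : Functor L! L
  F! = record
    { F₀     = !₀
    ; F₁     = λ f → p _ ⨾ !₁ f
    ; F-id   = p-dʳ
    ; F-⨾    = λ {_} {_} {_} {f} {g} → begin
        p _ ⨾ !₁ (p _ ⨾ !₁ f ⨾ g)          ≈⟨ ⨾-congˡ (≈-trans !-⨾ (⨾-congˡ !-⨾)) ⟩
        p _ ⨾ !₁ (p _) ⨾ !₁ (!₁ f) ⨾ !₁ g  ≈⟨ swap p-assoc ⟨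
        p _ ⨾ p _ ⨾ !₁ (!₁ f) ⨾ !₁ g       ≈⟨ ⨾-congˡ (swap (p-natural f)) ⟨
        p _ ⨾ !₁ f ⨾ p _ ⨾ !₁ g            ≈⟨ assoc ⟨
        (p _ ⨾ !₁ f) ⨾ p _ ⨾ !₁ g          ∎
    ; F-cong = λ q → ⨾-congˡ (!-cong q)
    }

  F!-d⨾ : ∀ {A B} {f : A ⇒ B} → p _ ⨾ !₁ (d _ ⨾ f) ≈ !₁ f
  F!-d⨾ = ≈-trans (⨾-congˡ !-⨾) (cancel p-dʳ)

  F!-d : ∀ {A B} {f : !₀ A ⇒ B} → (p _ ⨾ !₁ f) ⨾ d _ ≈ f
  F!-d {f = f} = ≈-trans assoc (≈-trans (⨾-congˡ (d-natural f)) (cancel p-dˡ))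

  d⨾-K⨾ : ∀ {A B C} {f : A ⇒ B} {g : !₀ B ⇒ C} → (d _ ⨾ f) K.⨾ g ≈ !₁ f ⨾ g
  d⨾-K⨾ = pull F!-d⨾

  K⨾-d⨾ : ∀ {A B C} {f : !₀ A ⇒ B} {g : B ⇒ C} → f K.⨾ (d _ ⨾ g) ≈ f ⨾ g
  K⨾-d⨾ = ≈-trans (≈-sym assoc) (≈-trans (≈-sym assoc) (⨾-congʳ F!-d))

  U! : Functor L L!
  U! = record
    { F₀     = λ A → A
    ; F₁     = λ u → d _ ⨾ u
    ; F-id   = identityʳ
    ; F-⨾    = ≈-sym (≈-trans K⨾-d⨾ assoc)
    ; F-cong = ⨾-congˡ
    }

  module _ (Q : Cartesian L) where
    private module Q = Cartesian Q

    L!-cartesian : Cartesian L!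
    L!-cartesian = record
      { 𝟙        = Q.𝟙
      ; ⊤        = Q.⊤
      ; ⊤-unique = Q.⊤-unique
      ; _×₀_     = Q._×₀_
      ; π₁       = d _ ⨾ Q.π₁
      ; π₂       = d _ ⨾ Q.π₂
      ; ⟨_,_⟩    = Q.⟨_,_⟩
      ; project₁ = ≈-trans K⨾-d⨾ Q.project₁
      ; project₂ = ≈-trans K⨾-d⨾ Q.project₂
      ; unique   = λ q r → Q.unique (≈-trans (≈-sym K⨾-d⨾) q) (≈-trans (≈-sym K⨾-d⨾) r)
      }

record SeelyCategory (o ℓ e : Level) : Set (lsuc (o ⊔ ℓ ⊔ e)) where
  field
    L        : Category o ℓ e
    monoidal : SymmetricMonoidal L
    products : Cartesian L
    comonad  : Comonad L
  open Category L
  open Cartesian products using (_×₀_; π₁; π₂; ⟨_,_⟩)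
  open SymmetricMonoidal monoidal using (_⊗₁_)
  open Comonad comonad using (!; !₁; p)
  -- The Seely isomorphisms μ : !A ⊗ !B ≅ !(A × B) and μ₀ : 1 ≅ !𝟙 make ! a
  -- symmetric monoidal functor, compatibly with the comultiplication.
  field
    seely   : StrongSymmetricMonoidal (Cartesian.symmetricMonoidal products) monoidal !
  open StrongSymmetricMonoidal seely using (μ)
  field
    seely-p : ∀ {A B} →
              μ ⨾ p (A ×₀ B) ⨾ !₁ ⟨ !₁ π₁ , !₁ π₂ ⟩ ≈ (p A ⊗₁ p B) ⨾ μ

module CanonicalLNL {o ℓ e} (S : SeelyCategory o ℓ e) where
  open SeelyCategory S
  open Category L
  open SymmetricMonoidal monoidal
  open Cartesian products
  open Comonad comonad
  open StrongSymmetricMonoidal seely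
  open CoKleisli comonad
  open HomReasoning
  private
    module K  = Category L!
    module KC = Cartesian (L!-cartesian products)

  K-×₁ : ∀ {A B A′ B′} {f : !₀ A ⇒ B} {g : !₀ A′ ⇒ B′} →
         f KC.×₁ g ≈ ⟨ !₁ π₁ , !₁ π₂ ⟩ ⨾ (f ×₁ g)
  K-×₁ = ≈-trans (⟨⟩-cong d⨾-K⨾ d⨾-K⨾) (≈-sym ⟨⟩-×₁)

  d⨾-π-K⨾-π : ∀ {A B C} {f : A ⇒ B} {g : B ⇒ C} → (d _ ⨾ f) K.⨾ (d _ ⨾ g) ≈ d _ ⨾ f ⨾ g
  d⨾-π-K⨾-π = ≈-trans K⨾-d⨾ assoc

  K-α : ∀ {A B C} → KC.×α⇒ {A} {B} {C} ≈ d _ ⨾ ×α⇒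
  K-α = ≈-sym (≈-trans ⨾-⟨⟩ (⟨⟩-cong (≈-sym d⨾-π-K⨾-π)
                 (≈-trans ⨾-⟨⟩ (⟨⟩-cong (≈-sym d⨾-π-K⨾-π) ≈-refl))))

  K-σ : ∀ {A B} → KC.×σ {A} {B} ≈ d _ ⨾ ×σ
  K-σ = ≈-sym ⨾-⟨⟩

  F!-strong : StrongSymmetricMonoidal (Cartesian.symmetricMonoidal (L!-cartesian products)) monoidal F!
  F!-strong = record
    { lax = record
        { μ  = μ
        ; μ₀ = μ₀
        ; μ-natural = λ {_} {_} {_} {_} {f} {g} → begin
            ((p _ ⨾ !₁ f) ⊗₁ (p _ ⨾ !₁ g)) ⨾ μ
              ≈⟨ ≈-trans (⨾-congʳ ⊗-⨾) assoc ⟩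
            (p _ ⊗₁ p _) ⨾ (!₁ f ⊗₁ !₁ g) ⨾ μ
              ≈⟨ ⨾-congˡ μ-natural ⟩
            (p _ ⊗₁ p _) ⨾ μ ⨾ !₁ (f ×₁ g)
              ≈⟨ pull (≈-sym seely-p) ⟩
            (μ ⨾ p _ ⨾ !₁ ⟨ !₁ π₁ , !₁ π₂ ⟩) ⨾ !₁ (f ×₁ g)
              ≈⟨ ≈-trans assoc (⨾-congˡ assoc) ⟩
            μ ⨾ p _ ⨾ !₁ ⟨ !₁ π₁ , !₁ π₂ ⟩ ⨾ !₁ (f ×₁ g)
              ≈⟨ ⨾-congˡ (⨾-congˡ (≈-trans (≈-sym !-⨾) (!-cong (≈-sym K-×₁)))) ⟩
            μ ⨾ p _ ⨾ !₁ (f KC.×₁ g) ∎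
        ; μ-assoc = ≈-trans (⨾-congˡ (⨾-congˡ (≈-trans (⨾-congˡ (!-cong K-α)) F!-d⨾))) μ-assoc
        ; μ-unitˡ = ≈-trans (⨾-congˡ (⨾-congˡ F!-d⨾)) μ-unitˡ
        ; μ-unitʳ = ≈-trans (⨾-congˡ (⨾-congˡ F!-d⨾)) μ-unitʳ
        ; μ-sym   = ≈-trans (⨾-congˡ (≈-trans (⨾-congˡ (!-cong K-σ)) F!-d⨾)) μ-sym
        }
    ; μ-iso  = μ-iso
    ; μ₀-iso = μ₀-iso
    }

  n : ∀ {A B} → !₀ (A ×₀ B) ⇒ A ⊗₀ B
  n = μ⁻¹ ⨾ (d _ ⊗₁ d _)

  ×₁-n : ∀ {A B A′ B′} {f : !₀ A ⇒ B} {g : !₀ A′ ⇒ B′} →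
         (f KC.×₁ g) K.⨾ n ≈ μ⁻¹ ⨾ (f ⊗₁ g)
  ×₁-n {f = f} {g} = begin
    p _ ⨾ !₁ (f KC.×₁ g) ⨾ μ⁻¹ ⨾ (d _ ⊗₁ d _)
      ≈⟨ ≈-trans (≈-sym assoc) (swap (StrongSymmetricMonoidal.μ⁻¹-natural F!-strong)) ⟩
    μ⁻¹ ⨾ ((p _ ⨾ !₁ f) ⊗₁ (p _ ⨾ !₁ g)) ⨾ (d _ ⊗₁ d _)
      ≈⟨ ⨾-congˡ (⊗-merge F!-d F!-d) ⟩
    μ⁻¹ ⨾ (f ⊗₁ g) ∎

  ×₁-n-U : ∀ {A B A′ B′ C} {f : !₀ A ⇒ B} {g : !₀ A′ ⇒ B′} {u : B ⊗₀ B′ ⇒ C} →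
           (f KC.×₁ g) K.⨾ n K.⨾ (d _ ⨾ u) ≈ μ⁻¹ ⨾ (f ⊗₁ g) ⨾ u
  ×₁-n-U = ≈-trans (K.≈-sym K.assoc) (≈-trans K⨾-d⨾ (≈-trans (⨾-congʳ ×₁-n) assoc))

  n-natural : ∀ {A B A′ B′} {f : A ⇒ A′} {g : B ⇒ B′} →
              ((d A ⨾ f) KC.×₁ (d B ⨾ g)) K.⨾ n ≈ n K.⨾ (d _ ⨾ (f ⊗₁ g))
  n-natural {A} {B} {A′} {B′} {f} {g} = begin
    ((d A ⨾ f) KC.×₁ (d B ⨾ g)) K.⨾ n    ≈⟨ ×₁-n ⟩
    μ⁻¹ ⨾ ((d A ⨾ f) ⊗₁ (d B ⨾ g))       ≈⟨ ⨾-congˡ ⊗-⨾ ⟩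
    μ⁻¹ ⨾ (d A ⊗₁ d B) ⨾ (f ⊗₁ g)        ≈⟨ assoc ⟨
    n ⨾ (f ⊗₁ g)                         ≈⟨ K⨾-d⨾ ⟨
    n K.⨾ (d _ ⨾ (f ⊗₁ g))               ∎

  n-assoc : ∀ {A B C} → (n {A} {B} KC.×₁ d C) K.⨾ n K.⨾ (d _ ⨾ α⇒) ≈
                        KC.×α⇒ {A} {B} {C} K.⨾ (d A KC.×₁ n {B} {C}) K.⨾ n
  n-assoc {A} {B} {C} = begin
    (n KC.×₁ d C) K.⨾ n K.⨾ (d _ ⨾ α⇒)
      ≈⟨ ×₁-n-U ⟩
    μ⁻¹ ⨾ (n ⊗₁ d C) ⨾ α⇒
      ≈⟨ ⨾-congˡ (pull (⊗-merge ≈-refl identityˡ)) ⟨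
    μ⁻¹ ⨾ (μ⁻¹ ⊗₁ id) ⨾ ((d A ⊗₁ d B) ⊗₁ d C) ⨾ α⇒
      ≈⟨ ⨾-congˡ (⨾-congˡ α-natural) ⟩
    μ⁻¹ ⨾ (μ⁻¹ ⊗₁ id) ⨾ α⇒ ⨾ (d A ⊗₁ (d B ⊗₁ d C))
      ≈⟨ ⨾-congˡ assoc ⟨
    μ⁻¹ ⨾ ((μ⁻¹ ⊗₁ id) ⨾ α⇒) ⨾ (d A ⊗₁ (d B ⊗₁ d C))
      ≈⟨ pull μ⁻¹-assoc ⟩
    (!₁ ×α⇒ ⨾ μ⁻¹ ⨾ (id ⊗₁ μ⁻¹)) ⨾ (d A ⊗₁ (d B ⊗₁ d C))
      ≈⟨ ≈-trans assoc (⨾-congˡ assoc) ⟩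
    !₁ ×α⇒ ⨾ μ⁻¹ ⨾ (id ⊗₁ μ⁻¹) ⨾ (d A ⊗₁ (d B ⊗₁ d C))
      ≈⟨ ⨾-congˡ (⨾-congˡ (⊗-merge identityˡ ≈-refl)) ⟩
    !₁ ×α⇒ ⨾ μ⁻¹ ⨾ (d A ⊗₁ n)
      ≈⟨ d⨾-K⨾ ⟨
    (d _ ⨾ ×α⇒) K.⨾ (μ⁻¹ ⨾ (d A ⊗₁ n))
      ≈⟨ K.⨾-cong K-α ×₁-n ⟨
    KC.×α⇒ {A} {B} {C} K.⨾ (d A KC.×₁ n) K.⨾ n ∎

  n-unitˡ : ∀ {A} → (μ₀⁻¹ KC.×₁ d A) K.⨾ n K.⨾ (d _ ⨾ λ⇒) ≈ d _ ⨾ π₂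
  n-unitˡ {A} = begin
    (μ₀⁻¹ KC.×₁ d A) K.⨾ n K.⨾ (d _ ⨾ λ⇒)      ≈⟨ ×₁-n-U ⟩
    μ⁻¹ ⨾ (μ₀⁻¹ ⊗₁ d A) ⨾ λ⇒                   ≈⟨ ⨾-congˡ (pull (⊗-merge identityʳ identityˡ)) ⟨
    μ⁻¹ ⨾ (μ₀⁻¹ ⊗₁ id) ⨾ (id ⊗₁ d A) ⨾ λ⇒      ≈⟨ ⨾-congˡ (⨾-congˡ λ-natural) ⟩
    μ⁻¹ ⨾ (μ₀⁻¹ ⊗₁ id) ⨾ λ⇒ ⨾ d A              ≈⟨ ⨾-congˡ assoc ⟨
    μ⁻¹ ⨾ ((μ₀⁻¹ ⊗₁ id) ⨾ λ⇒) ⨾ d A            ≈⟨ pull μ⁻¹-unitˡ ⟩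
    !₁ π₂ ⨾ d A                                ≈⟨ d-natural π₂ ⟩
    d _ ⨾ π₂                                   ∎

  n-unitʳ : ∀ {A} → (d A KC.×₁ μ₀⁻¹) K.⨾ n K.⨾ (d _ ⨾ ρ⇒) ≈ d _ ⨾ π₁
  n-unitʳ {A} = begin
    (d A KC.×₁ μ₀⁻¹) K.⨾ n K.⨾ (d _ ⨾ ρ⇒)      ≈⟨ ×₁-n-U ⟩
    μ⁻¹ ⨾ (d A ⊗₁ μ₀⁻¹) ⨾ ρ⇒                   ≈⟨ ⨾-congˡ (pull (⊗-merge identityˡ identityʳ)) ⟨
    μ⁻¹ ⨾ (id ⊗₁ μ₀⁻¹) ⨾ (d A ⊗₁ id) ⨾ ρ⇒      ≈⟨ ⨾-congˡ (⨾-congˡ ρ-natural) ⟩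
    μ⁻¹ ⨾ (id ⊗₁ μ₀⁻¹) ⨾ ρ⇒ ⨾ d A              ≈⟨ ⨾-congˡ assoc ⟨
    μ⁻¹ ⨾ ((id ⊗₁ μ₀⁻¹) ⨾ ρ⇒) ⨾ d A            ≈⟨ pull μ⁻¹-unitʳ ⟩
    !₁ π₁ ⨾ d A                                ≈⟨ d-natural π₁ ⟩
    d _ ⨾ π₁                                   ∎

  n-sym : ∀ {A B} → n {A} {B} K.⨾ (d _ ⨾ σ) ≈ KC.×σ {A} {B} K.⨾ n
  n-sym {A} {B} = begin
    n K.⨾ (d _ ⨾ σ)               ≈⟨ ≈-trans K⨾-d⨾ assoc ⟩
    μ⁻¹ ⨾ (d A ⊗₁ d B) ⨾ σ        ≈⟨ ⨾-congˡ σ-natural ⟩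
    μ⁻¹ ⨾ σ ⨾ (d B ⊗₁ d A)        ≈⟨ swap μ⁻¹-sym ⟩
    !₁ ×σ ⨾ μ⁻¹ ⨾ (d B ⊗₁ d A)    ≈⟨ d⨾-K⨾ ⟨
    (d _ ⨾ ×σ) K.⨾ n              ≈⟨ K.⨾-congʳ K-σ ⟨
    KC.×σ {A} {B} K.⨾ n           ∎

  U!-lax : LaxSymmetricMonoidal monoidal (Cartesian.symmetricMonoidal (L!-cartesian products)) U!
  U!-lax = record
    { μ         = n
    ; μ₀        = μ₀⁻¹
    ; μ-natural = n-natural
    ; μ-assoc   = n-assoc
    ; μ-unitˡ   = n-unitˡ
    ; μ-unitʳ   = n-unitʳ
    ; μ-sym     = n-sym
    }

  η-monoidal : ∀ {A B} → (id { !₀ A} KC.×₁ id { !₀ B}) K.⨾ n K.⨾ (d _ ⨾ μ) ≈ id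
  η-monoidal = begin
    (id KC.×₁ id) K.⨾ n K.⨾ (d _ ⨾ μ)  ≈⟨ ×₁-n-U ⟩
    μ⁻¹ ⨾ (id ⊗₁ id) ⨾ μ               ≈⟨ ⨾-congˡ (cancelid ⊗-id) ⟩
    μ⁻¹ ⨾ μ                            ≈⟨ μ-isoʳ ⟩
    id                                 ∎
    where
      cancelid : ∀ {X Y} {f : X ⇒ X} {g : X ⇒ Y} → f ≈ id → f ⨾ g ≈ g
      cancelid q = ≈-trans (⨾-congʳ q) identityˡ

  ε-monoidal : ∀ {A B} → μ ⨾ (p _ ⨾ !₁ n) ⨾ d _ ≈ d A ⊗₁ d B
  ε-monoidal {A} {B} = begin
    μ ⨾ (p _ ⨾ !₁ n) ⨾ d _   ≈⟨ ⨾-congˡ F!-d ⟩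
    μ ⨾ μ⁻¹ ⨾ (d A ⊗₁ d B)   ≈⟨ cancel μ-isoˡ ⟩
    d A ⊗₁ d B               ∎

  η-natural : ∀ {A B} (f : !₀ A ⇒ B) → f K.⨾ id ≈ id K.⨾ (d _ ⨾ p A ⨾ !₁ f)
  η-natural {A} f = begin
    f K.⨾ id                      ≈⟨ ⨾-congˡ identityʳ ⟩
    p A ⨾ !₁ f                    ≈⟨ identityˡ ⟨
    id ⨾ p A ⨾ !₁ f               ≈⟨ K⨾-d⨾ ⟨
    id K.⨾ (d _ ⨾ p A ⨾ !₁ f)     ∎

  ε-natural : ∀ {A B} (f : A ⇒ B) → (p A ⨾ !₁ (d A ⨾ f)) ⨾ d B ≈ d A ⨾ f
  ε-natural f = F!-d

  zag : ∀ {A} → id { !₀ A} K.⨾ (d _ ⨾ d A) ≈ d A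
  zag = ≈-trans K⨾-d⨾ identityˡ

  η-monoidal₁ : μ₀⁻¹ K.⨾ (d _ ⨾ μ₀) ≈ id
  η-monoidal₁ = ≈-trans K⨾-d⨾ μ₀-isoʳ

  ε-monoidal₁ : μ₀ ⨾ (p _ ⨾ !₁ μ₀⁻¹) ⨾ d _ ≈ id
  ε-monoidal₁ = ≈-trans (⨾-congˡ F!-d) μ₀-isoˡ

  η! : NaturalTransformation idF (F! ⨾F U!)
  η! = record { at = λ A → id { !₀ A} ; natural = η-natural }

  ε! : NaturalTransformation (U! ⨾F F!) idF
  ε! = record { at = d ; natural = ε-natural }

  canonicalLNL : LNL (L!-cartesian products) monoidal
  canonicalLNL = record
    { F           = F!
    ; U           = U!
    ; F-strong    = F!-strong
    ; U-lax       = U!-lax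
    ; unit        = η!
    ; counit      = ε!
    ; zig         = λ {X} → F!-d {f = id { !₀ X}}
    ; zag         = λ {A} → zag {A}
    ; η-monoidal  = λ {X} {Y} → η-monoidal {X} {Y}
    ; η-monoidal₁ = η-monoidal₁
    ; ε-monoidal  = λ {A} {B} → ε-monoidal {A} {B}
    ; ε-monoidal₁ = ε-monoidal₁
    }

record DifferentialSeelyCategory (o ℓ e : Level) : Set (lsuc (o ⊔ ℓ ⊔ e)) where
  field
    seelyCategory : SeelyCategory o ℓ e
  open SeelyCategory seelyCategory public
  open Category L
  open SymmetricMonoidal monoidal
  open Comonad comonad
  open Comonoid products monoidal seely using (c; w)
  field
    additive : Additive monoidal
  open Additive additive
  field
    ∂ : ∀ A → !₀ A ⊗₀ A ⇒ !₀ A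
    ∂-natural : ∀ {A B} (f : A ⇒ B) → (!₁ f ⊗₁ f) ⨾ ∂ B ≈ ∂ A ⨾ !₁ f

    ∂-w : ∀ {A} → ∂ A ⨾ w ≈ 0#
    ∂-c : ∀ {A} →
          ∂ A ⨾ c ≈ (c ⊗₁ id) ⨾ ( α⇒ ⨾ (id ⊗₁ ∂ A)
                                + α⇒ ⨾ (id ⊗₁ σ) ⨾ α⇐ ⨾ (∂ A ⊗₁ id))
    ∂-d : ∀ {A} → ∂ A ⨾ d A ≈ (w ⊗₁ id) ⨾ λ⇒
    ∂-p : ∀ {A} → ∂ A ⨾ p A ≈ (c ⊗₁ id) ⨾ α⇒ ⨾ (p A ⊗₁ ∂ A) ⨾ ∂ (!₀ A)
    ∂-∂ : ∀ {A} → α⇒ ⨾ (id ⊗₁ σ) ⨾ α⇐ ⨾ (∂ A ⊗₁ id) ⨾ ∂ A ≈ (∂ A ⊗₁ id) ⨾ ∂ A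

{-# OPTIONS --safe #-}

-- The functor is 𝒯 f = (f , ∂ ⨾ f), so that lin A = A.  The chain rule ∂-p makes 𝒯 functorial and
-- the linear rule ∂-d makes it preserve identities and sends φ to the identity.  For (t.3), the
-- derivative of ⦃| f , u |⦄ along ι₂ vanishes in the first component, where ι₂ meets π₁; in the
-- second component the Leibniz rule ∂-c gives two terms, one vanishing for the same reason, and
-- the other being u by ∂-d.
module Submission where

open import Defs
open import Data.Product using (_,_; proj₂)
open import Algebra.Structures using (IsCommutativeMonoid)
open import Relation.Binary.PropositionalEquality using (refl)

module SymmetricMonoidalProperties {o ℓ e} {L : Category o ℓ e} (M : SymmetricMonoidal L) where
  open Category L
  open SymmetricMonoidal M
  open HomReasoning

  α⇐-natural : ∀ {A B C A′ B′ C′} {f : A ⇒ A′} {g : B ⇒ B′} {h : C ⇒ C′} →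
               (f ⊗₁ (g ⊗₁ h)) ⨾ α⇐ ≈ α⇐ ⨾ ((f ⊗₁ g) ⊗₁ h)
  α⇐-natural {f = f} {g} {h} = begin
    (f ⊗₁ (g ⊗₁ h)) ⨾ α⇐               ≈⟨ cancel (IsIso.isoʳ α-iso) ⟨
    α⇐ ⨾ α⇒ ⨾ (f ⊗₁ (g ⊗₁ h)) ⨾ α⇐     ≈⟨ ⨾-congˡ (swap α-natural) ⟨
    α⇐ ⨾ ((f ⊗₁ g) ⊗₁ h) ⨾ α⇒ ⨾ α⇐     ≈⟨ ⨾-congˡ (≈-trans (⨾-congˡ (IsIso.isoˡ α-iso)) identityʳ) ⟩
    α⇐ ⨾ ((f ⊗₁ g) ⊗₁ h)               ∎

-- Composition with linear maps in `LS`.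

module LinearSimpleProperties {o ℓ e o′ ℓ′ e′} {C : Category o ℓ e} {P : Cartesian C}
    {L : Category o′ ℓ′ e′} {M : SymmetricMonoidal L} (lnl : LNL P M) where
  private module C = Category C
  open Category L
  open SymmetricMonoidal M
  open LNL lnl using (F₀; F₁; c)
  open LinearSimple lnl
  open HomReasoning

  -- `c` duplicates only the non-linear argument, so a map on the linear argument alone slides past
  -- it.
  comp-precompose : ∀ {X Y A A′ B D} {f : X C.⇒ Y} {a : A ⇒ A′} {u : F₀ X ⊗₀ A′ ⇒ B}
                      {v : F₀ Y ⊗₀ B ⇒ D} →
                    (id ⊗₁ a) ⨾ comp f u v ≈ comp f ((id ⊗₁ a) ⨾ u) v
  comp-precompose {f = f} {a} {u} {v} = begin
    (id ⊗₁ a) ⨾ (c ⊗₁ id) ⨾ α⇒ ⨾ (F₁ f ⊗₁ u) ⨾ v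
      ≈⟨ swap (≈-trans (⊗-merge identityˡ identityʳ)
                       (≈-sym (⊗-merge (≈-trans (⨾-congˡ ⊗-id) identityʳ) identityˡ))) ⟩
    (c ⊗₁ id) ⨾ ((id ⊗₁ id) ⊗₁ a) ⨾ α⇒ ⨾ (F₁ f ⊗₁ u) ⨾ v
      ≈⟨ ⨾-congˡ (swap α-natural) ⟩
    (c ⊗₁ id) ⨾ α⇒ ⨾ (id ⊗₁ (id ⊗₁ a)) ⨾ (F₁ f ⊗₁ u) ⨾ v
      ≈⟨ ⨾-congˡ (⨾-congˡ (pull (⊗-merge identityˡ ≈-refl))) ⟩
    (c ⊗₁ id) ⨾ α⇒ ⨾ (F₁ f ⊗₁ ((id ⊗₁ a) ⨾ u)) ⨾ v ∎

  -- `w⊗ a` is `id ⊗₁ a` followed by the fibre `w⊗ id` of an identity; once `a` has slid out, the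
  -- left unit law of `LS` removes that identity.
  comp-id-w⊗ : ∀ {X A B D} {a : A ⇒ B} {v : F₀ X ⊗₀ B ⇒ D} →
               comp C.id (w⊗ a) v ≈ (id ⊗₁ a) ⨾ v
  comp-id-w⊗ {a = a} {v} = begin
    comp C.id (w⊗ a) v                      ≈⟨ ⨾-congˡ (⨾-congˡ (⨾-congʳ (⊗-congˡ
                                                 (pull (⊗-merge identityˡ identityʳ))))) ⟨
    comp C.id ((id ⊗₁ a) ⨾ w⊗ id) v         ≈⟨ comp-precompose ⟨
    (id ⊗₁ a) ⨾ comp C.id (w⊗ id) v         ≈⟨ ⨾-congˡ (proj₂ (Category.identityˡ LS {f = ⟪ C.id , v ⟫})) ⟩
    (id ⊗₁ a) ⨾ v                           ∎

-- The comonoid structure on `!A`.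

module SeelyComonoid {o ℓ e} (S : SeelyCategory o ℓ e) where
  open SeelyCategory S
  open Category L
  open SymmetricMonoidal monoidal
  open Cartesian products
  open Comonad comonad
  open StrongSymmetricMonoidal seely using (μ⁻¹; μ⁻¹-natural)
  open CoKleisli comonad using (F!-d⨾)
  open Comonoid products monoidal seely using (c; w; F-merge; c-w-unitʳ)
  open HomReasoning
  private module N = LNL (CanonicalLNL.canonicalLNL S)

  -- The diagonal of `L!` is `d ⨾ Δ`, and `F!` sends `d ⨾ f` to `!₁ f`. Needed because `LS` uses the
  -- contraction obtained from `F!`, while the rules for `∂` use the one obtained from `!`.
  canonical-c≈c : ∀ {A} → N.c {A} ≈ c
  canonical-c≈c = ⨾-congʳ (≈-trans (⨾-congˡ (!-cong (≈-sym
    (≈-trans ⨾-⟨⟩ (⟨⟩-cong identityʳ identityʳ))))) F!-d⨾)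

  canonical-w≈w : ∀ {A} → N.w {A} ≈ w
  canonical-w≈w = ⨾-congʳ (≈-trans (⨾-congˡ (!-cong 𝟙-ext)) F!-d⨾)

  -- Puts the Seely isomorphism in a form that the Leibniz rule `∂-c` can differentiate.
  μ⁻¹-via-c : ∀ {A B} → μ⁻¹ {A} {B} ≈ c ⨾ (!₁ π₁ ⊗₁ !₁ π₂)
  μ⁻¹-via-c = begin
    μ⁻¹                             ≈⟨ identityˡ ⟨
    id ⨾ μ⁻¹                        ≈⟨ ⨾-congʳ !-id ⟨
    !₁ id ⨾ μ⁻¹                     ≈⟨ ⨾-congʳ (F-merge (≈-trans ⟨⟩-×₁
                                         (≈-trans (⟨⟩-cong identityˡ identityˡ) ⟨π₁,π₂⟩≈id))) ⟨
    (!₁ Δ ⨾ !₁ (π₁ ×₁ π₂)) ⨾ μ⁻¹    ≈⟨ assoc ⟩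
    !₁ Δ ⨾ !₁ (π₁ ×₁ π₂) ⨾ μ⁻¹      ≈⟨ ⨾-congˡ μ⁻¹-natural ⟩
    !₁ Δ ⨾ μ⁻¹ ⨾ (!₁ π₁ ⊗₁ !₁ π₂)   ≈⟨ assoc ⟨
    c ⨾ (!₁ π₁ ⊗₁ !₁ π₂)            ∎

  -- The counit law of `c` beside a spectator `A`: `triangle` trades the left unitor at `A` for the
  -- right unitor in `c-w-unitʳ`.
  c⊗-w-counit : ∀ {X A} → (c {X} ⊗₁ id {A}) ⨾ α⇒ ⨾ (id ⊗₁ ((w ⊗₁ id) ⨾ λ⇒)) ≈ id
  c⊗-w-counit = begin
    (c ⊗₁ id) ⨾ α⇒ ⨾ (id ⊗₁ ((w ⊗₁ id) ⨾ λ⇒))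
      ≈⟨ ⨾-congˡ (⨾-congˡ (⊗-merge identityˡ ≈-refl)) ⟨
    (c ⊗₁ id) ⨾ α⇒ ⨾ (id ⊗₁ (w ⊗₁ id)) ⨾ (id ⊗₁ λ⇒)
      ≈⟨ ⨾-congˡ (swap α-natural) ⟨
    (c ⊗₁ id) ⨾ ((id ⊗₁ w) ⊗₁ id) ⨾ α⇒ ⨾ (id ⊗₁ λ⇒)
      ≈⟨ ⨾-congˡ (⨾-congˡ triangle) ⟩
    (c ⊗₁ id) ⨾ ((id ⊗₁ w) ⊗₁ id) ⨾ (ρ⇒ ⊗₁ id)
      ≈⟨ ⨾-congˡ (⊗-merge ≈-refl identityˡ) ⟩
    (c ⊗₁ id) ⨾ (((id ⊗₁ w) ⨾ ρ⇒) ⊗₁ id)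
      ≈⟨ ≈-trans (⊗-merge c-w-unitʳ identityˡ) ⊗-id ⟩
    id ∎

-- The functor `𝒯` and its comparison map `φ`.

module CanonicalDifferential {o ℓ e} (S : DifferentialSeelyCategory o ℓ e) where
  open DifferentialSeelyCategory S
  open Category L
  open SymmetricMonoidal monoidal
  open Cartesian products
  open SymmetricMonoidalProperties monoidal using (α⇐-natural)
  open Comonad comonad
  open StrongSymmetricMonoidal seely using (μ⁻¹)
  open CoKleisli comonad
  open Comonoid products monoidal seely using (c; w)
  open Additive additive
  open Biproducts additive products using (ι₂)
  open CanonicalLNL seelyCategory using (canonicalLNL; ×₁-n-U)
  open LinearSimple canonicalLNL
  open LinearSimpleProperties canonicalLNL
  open SeelyComonoid seelyCategory
  open HomReasoning
  private
    module K = Category L!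
    module LS = Category LS
    module LSC = Cartesian (LS-cartesian products)
    module N = LNL canonicalLNL
    open module +-monoid {A B : Obj} = IsCommutativeMonoid (+-isCommutativeMonoid {A} {B})
      using () renaming (identityʳ to +-identityʳ; ∙-cong to +-cong)

  -- The linear rule with `u` carried along. Taking `u = id` gives the identity law of `𝒯`, and a
  -- projection gives `φ`.
  ∂-d⨾ : ∀ {A B} {u : A ⇒ B} → ∂ A ⨾ d A ⨾ u ≈ w⊗ u
  ∂-d⨾ {A} {u = u} = begin
    ∂ A ⨾ d A ⨾ u               ≈⟨ pull ∂-d ⟩
    ((w ⊗₁ id) ⨾ λ⇒) ⨾ u        ≈⟨ assoc ⟩
    (w ⊗₁ id) ⨾ λ⇒ ⨾ u          ≈⟨ ⨾-congˡ λ-natural ⟨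
    (w ⊗₁ id) ⨾ (id ⊗₁ u) ⨾ λ⇒  ≈⟨ pull (⊗-merge identityʳ identityˡ) ⟩
    (w ⊗₁ u) ⨾ λ⇒               ≈⟨ ⨾-congʳ (⊗-congʳ canonical-w≈w) ⟨
    w⊗ u                        ∎

  -- After `∂-p`, naturality moves `!₁ f` in front of the outer `∂`; the resulting `p A ⨾ !₁ f` is
  -- `F! f`, which is the shape of composition in `LS`.
  ∂-K⨾ : ∀ {A B C} {f : !₀ A ⇒ B} {g : !₀ B ⇒ C} →
         ∂ A ⨾ (f K.⨾ g) ≈ comp f (∂ A ⨾ f) (∂ B ⨾ g)
  ∂-K⨾ {A} {B} {f = f} {g} = begin
    ∂ A ⨾ p A ⨾ !₁ f ⨾ g
      ≈⟨ pull ∂-p ⟩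
    ((c ⊗₁ id) ⨾ α⇒ ⨾ (p A ⊗₁ ∂ A) ⨾ ∂ (!₀ A)) ⨾ !₁ f ⨾ g
      ≈⟨ ≈-trans assoc (⨾-congˡ (≈-trans assoc (⨾-congˡ assoc))) ⟩
    (c ⊗₁ id) ⨾ α⇒ ⨾ (p A ⊗₁ ∂ A) ⨾ ∂ (!₀ A) ⨾ !₁ f ⨾ g
      ≈⟨ ⨾-congˡ (⨾-congˡ (⨾-congˡ (swap (∂-natural f)))) ⟨
    (c ⊗₁ id) ⨾ α⇒ ⨾ (p A ⊗₁ ∂ A) ⨾ (!₁ f ⊗₁ f) ⨾ ∂ B ⨾ g
      ≈⟨ ⨾-congˡ (⨾-congˡ (pull (≈-sym ⊗-⨾))) ⟩
    (c ⊗₁ id) ⨾ α⇒ ⨾ ((p A ⨾ !₁ f) ⊗₁ (∂ A ⨾ f)) ⨾ ∂ B ⨾ g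
      ≈⟨ ⨾-congʳ (⊗-congʳ canonical-c≈c) ⟨
    comp f (∂ A ⨾ f) (∂ B ⨾ g) ∎

  𝒯 : Functor L! LS
  𝒯 = record
    { F₀     = λ A → A , A
    ; F₁     = λ f → ⟪ f , ∂ _ ⨾ f ⟫
    ; F-id   = ≈-refl , ≈-trans (⨾-congˡ (≈-sym identityʳ)) ∂-d⨾
    ; F-⨾    = ≈-refl , ∂-K⨾
    ; F-cong = λ q → q , ⨾-congˡ q
    }
  open Functor 𝒯 using () renaming (F₁ to 𝒯₁)

  -- The trailing `LS.id` is what the `cast` in the definition of `φ` reduces to here.
  φ≈id : ∀ {A B} → LSC.⟨ 𝒯₁ (d (A ×₀ B) ⨾ π₁) , 𝒯₁ (d (A ×₀ B) ⨾ π₂) ⟩ LS.⨾ LS.id LS.≈ LS.id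
  φ≈id = LS.≈-trans LS.identityʳ
    (LS.≈-trans (LSC.⟨⟩-cong (≈-refl , ∂-d⨾) (≈-refl , ∂-d⨾)) LSC.⟨π₁,π₂⟩≈id)

  -- Differentiation along `ι₂`.

  ι₂-∂-π₁ : ∀ {X A} → (id ⊗₁ ι₂) ⨾ ∂ (X ×₀ A) ⨾ !₁ π₁ ≈ 0#
  ι₂-∂-π₁ {X} {A} = begin
    (id ⊗₁ ι₂) ⨾ ∂ (X ×₀ A) ⨾ !₁ π₁     ≈⟨ ⨾-congˡ (∂-natural π₁) ⟨
    -- Naturality has moved `π₁` onto the direction, where `ι₂` annihilates it.
    (id ⊗₁ ι₂) ⨾ (!₁ π₁ ⊗₁ π₁) ⨾ ∂ X    ≈⟨ pull (⊗-merge identityˡ project₁) ⟩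
    (!₁ π₁ ⊗₁ 0#) ⨾ ∂ X                 ≈⟨ ⨾-congʳ ⊗-zeroʳ ⟩
    0# ⨾ ∂ X                            ≈⟨ ⨾-zeroˡ ⟩
    0#                                  ∎

  ι₂-∂-π₂-d : ∀ {X A} → (id ⊗₁ ι₂) ⨾ ∂ (X ×₀ A) ⨾ !₁ π₂ ⨾ d A ≈ (w ⊗₁ id) ⨾ λ⇒
  ι₂-∂-π₂-d {X} {A} = begin
    (id ⊗₁ ι₂) ⨾ ∂ (X ×₀ A) ⨾ !₁ π₂ ⨾ d A  ≈⟨ ⨾-congˡ (⨾-congˡ (d-natural π₂)) ⟩
    (id ⊗₁ ι₂) ⨾ ∂ (X ×₀ A) ⨾ d _ ⨾ π₂     ≈⟨ ⨾-congˡ ∂-d⨾ ⟩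
    (id ⊗₁ ι₂) ⨾ (N.w ⊗₁ π₂) ⨾ λ⇒          ≈⟨ pull (⊗-merge identityˡ project₂) ⟩
    (N.w ⊗₁ id) ⨾ λ⇒                       ≈⟨ ⨾-congʳ (⊗-congʳ canonical-w≈w) ⟩
    (w ⊗₁ id) ⨾ λ⇒                         ∎

  ι₂-∂-μ⁻¹ : ∀ {X A} → (id ⊗₁ ι₂) ⨾ ∂ (X ×₀ A) ⨾ μ⁻¹ ⨾ (id ⊗₁ d A) ≈ !₁ π₁ ⊗₁ id
  ι₂-∂-μ⁻¹ {X} {A} = begin
    (id ⊗₁ ι₂) ⨾ ∂ _ ⨾ μ⁻¹ ⨾ (id ⊗₁ d A)
      ≈⟨ ⨾-congˡ (⨾-congˡ (≈-trans (⨾-congʳ μ⁻¹-via-c) (≈-trans assoc (⨾-congˡ (⊗-merge identityʳ ≈-refl))))) ⟩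
    (id ⊗₁ ι₂) ⨾ ∂ _ ⨾ c ⨾ k
      ≈⟨ ⨾-congˡ (≈-trans (pull ∂-c) assoc) ⟩
    (id ⊗₁ ι₂) ⨾ (c ⊗₁ id) ⨾ (leibniz₁ + leibniz₂) ⨾ k
      ≈⟨ swap ι₂-c ⟩
    (c ⊗₁ id) ⨾ ((id ⊗₁ id) ⊗₁ ι₂) ⨾ (leibniz₁ + leibniz₂) ⨾ k
      ≈⟨ ⨾-congˡ (≈-trans (⨾-congˡ ⨾-distribʳ) ⨾-distribˡ) ⟩
    (c ⊗₁ id) ⨾ (((id ⊗₁ id) ⊗₁ ι₂) ⨾ leibniz₁ ⨾ k + ((id ⊗₁ id) ⊗₁ ι₂) ⨾ leibniz₂ ⨾ k)
      ≈⟨ ⨾-congˡ (≈-trans (+-cong term₁ term₂) (+-identityʳ _)) ⟩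
    (c ⊗₁ id) ⨾ α⇒ ⨾ (id ⊗₁ ((w ⊗₁ id) ⨾ λ⇒)) ⨾ (!₁ π₁ ⊗₁ id)
      -- The weakening left by the linear rule discards the second copy made by `c`.
      ≈⟨ ≈-trans (⨾-congˡ (≈-sym assoc)) (cancel c⊗-w-counit) ⟩
    !₁ π₁ ⊗₁ id ∎
    where
      k : !₀ (X ×₀ A) ⊗₀ !₀ (X ×₀ A) ⇒ !₀ X ⊗₀ A
      k = !₁ π₁ ⊗₁ (!₁ π₂ ⨾ d A)

      leibniz₁ leibniz₂ : (!₀ (X ×₀ A) ⊗₀ !₀ (X ×₀ A)) ⊗₀ (X ×₀ A) ⇒
                          !₀ (X ×₀ A) ⊗₀ !₀ (X ×₀ A)
      leibniz₁ = α⇒ ⨾ (id ⊗₁ ∂ _)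
      leibniz₂ = α⇒ ⨾ (id ⊗₁ σ) ⨾ α⇐ ⨾ (∂ _ ⊗₁ id)

      ι₂-c : (id ⊗₁ ι₂) ⨾ (c {X ×₀ A} ⊗₁ id) ≈ (c ⊗₁ id) ⨾ ((id ⊗₁ id) ⊗₁ ι₂ {X} {A})
      ι₂-c = ≈-trans (⊗-merge identityˡ identityʳ)
                     (≈-sym (⊗-merge (≈-trans (⨾-congˡ ⊗-id) identityʳ) identityˡ))

      -- Here `∂` acts on the copy that `k` reads linearly through `π₂`, so the linear rule returns
      -- the direction itself.
      term₁ : ((id ⊗₁ id) ⊗₁ ι₂) ⨾ leibniz₁ ⨾ k ≈
              α⇒ ⨾ (id ⊗₁ ((w ⊗₁ id) ⨾ λ⇒)) ⨾ (!₁ π₁ ⊗₁ id)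
      term₁ = begin
        ((id ⊗₁ id) ⊗₁ ι₂) ⨾ leibniz₁ ⨾ k
          ≈⟨ ⨾-congˡ assoc ⟩
        ((id ⊗₁ id) ⊗₁ ι₂) ⨾ α⇒ ⨾ (id ⊗₁ ∂ _) ⨾ k
          ≈⟨ swap α-natural ⟩
        α⇒ ⨾ (id ⊗₁ (id ⊗₁ ι₂)) ⨾ (id ⊗₁ ∂ _) ⨾ k
          ≈⟨ ⨾-congˡ (≈-trans (⨾-congˡ (⊗-merge identityˡ ≈-refl)) (⊗-merge identityˡ ι₂-∂-π₂-d)) ⟩
        α⇒ ⨾ (!₁ π₁ ⊗₁ ((w ⊗₁ id) ⨾ λ⇒))
          ≈⟨ ⨾-congˡ (⊗-merge identityˡ identityʳ) ⟨
        α⇒ ⨾ (id ⊗₁ ((w ⊗₁ id) ⨾ λ⇒)) ⨾ (!₁ π₁ ⊗₁ id) ∎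

      -- Here `σ` carries the direction to the copy that `k` reads through `π₁`, on which `ι₂` gives
      -- zero.
      term₂ : ((id ⊗₁ id) ⊗₁ ι₂) ⨾ leibniz₂ ⨾ k ≈ 0#
      term₂ = begin
        ((id ⊗₁ id) ⊗₁ ι₂) ⨾ leibniz₂ ⨾ k
          ≈⟨ ⨾-congˡ (≈-trans assoc (⨾-congˡ (≈-trans assoc (⨾-congˡ assoc)))) ⟩
        ((id ⊗₁ id) ⊗₁ ι₂) ⨾ α⇒ ⨾ (id ⊗₁ σ) ⨾ α⇐ ⨾ (∂ _ ⊗₁ id) ⨾ k
          ≈⟨ swap α-natural ⟩
        α⇒ ⨾ (id ⊗₁ (id ⊗₁ ι₂)) ⨾ (id ⊗₁ σ) ⨾ α⇐ ⨾ (∂ _ ⊗₁ id) ⨾ k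
          ≈⟨ ⨾-congˡ (swap (≈-trans (⊗-merge ≈-refl σ-natural) ⊗-⨾)) ⟩
        α⇒ ⨾ (id ⊗₁ σ) ⨾ (id ⊗₁ (ι₂ ⊗₁ id)) ⨾ α⇐ ⨾ (∂ _ ⊗₁ id) ⨾ k
          ≈⟨ ⨾-congˡ (⨾-congˡ (swap α⇐-natural)) ⟩
        α⇒ ⨾ (id ⊗₁ σ) ⨾ α⇐ ⨾ ((id ⊗₁ ι₂) ⊗₁ id) ⨾ (∂ _ ⊗₁ id) ⨾ k
          ≈⟨ ⨾-congˡ (⨾-congˡ (⨾-congˡ (≈-trans (⨾-congˡ (⊗-merge ≈-refl identityˡ)) (⊗-merge ι₂-∂-π₁ identityˡ)))) ⟩
        α⇒ ⨾ (id ⊗₁ σ) ⨾ α⇐ ⨾ (0# ⊗₁ (!₁ π₂ ⨾ d A))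
          ≈⟨ ⨾-congˡ (⨾-congˡ (≈-trans (⨾-congˡ ⊗-zeroˡ) ⨾-zeroʳ)) ⟩
        α⇒ ⨾ (id ⊗₁ σ) ⨾ 0#
          ≈⟨ ≈-trans (⨾-congˡ ⨾-zeroʳ) ⨾-zeroʳ ⟩
        0# ∎

  -- The square of axiom (t.3).

  open Cartesian (L!-cartesian products) using () renaming (_×₁_ to _K×₁_)

  -- The bracket of (t.3) unfolded at the canonical adjunction: `id` is the unit at `X`, and `d A`
  -- is the identity of `A` in `L!`.
  ⦃|_,_|⦄ : ∀ {X A Y B} → !₀ X ⇒ Y → !₀ X ⊗₀ A ⇒ B → !₀ (X ×₀ A) ⇒ Y ×₀ B
  ⦃|_,_|⦄ {X} {A} f u = ⟨ (d _ ⨾ π₁) K.⨾ f , (id K×₁ d A) K.⨾ N.n K.⨾ (d _ ⨾ u) ⟩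

  ι₂-∂-⦃⦄ : ∀ {X A Y B} {f : !₀ X ⇒ Y} {u : !₀ X ⊗₀ A ⇒ B} →
            (id ⊗₁ ι₂) ⨾ ∂ (X ×₀ A) ⨾ ⦃| f , u |⦄ ≈ ((N.F₁ (d _ ⨾ π₁) ⊗₁ id) ⨾ u) ⨾ ι₂
  ι₂-∂-⦃⦄ {X} {A} {f = f} {u} = begin
    (id ⊗₁ ι₂) ⨾ ∂ _ ⨾ ⦃| f , u |⦄
      ≈⟨ ≈-trans (⨾-congˡ ⨾-⟨⟩) ⨾-⟨⟩ ⟩
    ⟨ (id ⊗₁ ι₂) ⨾ ∂ _ ⨾ ((d _ ⨾ π₁) K.⨾ f) , (id ⊗₁ ι₂) ⨾ ∂ _ ⨾ ((id K×₁ d A) K.⨾ N.n K.⨾ (d _ ⨾ u)) ⟩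
      ≈⟨ ⟨⟩-cong first second ⟩
    -- The factors `0#` and `id` are the components of `ι₂`, so the pair refolds into a composite
    -- with `ι₂`.
    ⟨ ((N.F₁ (d _ ⨾ π₁) ⊗₁ id) ⨾ u) ⨾ 0# , ((N.F₁ (d _ ⨾ π₁) ⊗₁ id) ⨾ u) ⨾ id ⟩
      ≈⟨ ⨾-⟨⟩ ⟨
    ((N.F₁ (d _ ⨾ π₁) ⊗₁ id) ⨾ u) ⨾ ι₂ ∎
    where
      first : (id ⊗₁ ι₂) ⨾ ∂ _ ⨾ ((d _ ⨾ π₁) K.⨾ f) ≈ ((N.F₁ (d _ ⨾ π₁) ⊗₁ id) ⨾ u) ⨾ 0#
      first = begin
        (id ⊗₁ ι₂) ⨾ ∂ _ ⨾ ((d _ ⨾ π₁) K.⨾ f)  ≈⟨ ⨾-congˡ (⨾-congˡ d⨾-K⨾) ⟩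
        (id ⊗₁ ι₂) ⨾ ∂ _ ⨾ !₁ π₁ ⨾ f           ≈⟨ ⨾-congˡ assoc ⟨
        (id ⊗₁ ι₂) ⨾ (∂ _ ⨾ !₁ π₁) ⨾ f         ≈⟨ pull ι₂-∂-π₁ ⟩
        0# ⨾ f                                 ≈⟨ ⨾-zeroˡ ⟩
        0#                                     ≈⟨ ⨾-zeroʳ ⟨
        ((N.F₁ (d _ ⨾ π₁) ⊗₁ id) ⨾ u) ⨾ 0#     ∎

      second : (id ⊗₁ ι₂) ⨾ ∂ _ ⨾ ((id K×₁ d A) K.⨾ N.n K.⨾ (d _ ⨾ u)) ≈
               ((N.F₁ (d _ ⨾ π₁) ⊗₁ id) ⨾ u) ⨾ id
      second = begin
        (id ⊗₁ ι₂) ⨾ ∂ _ ⨾ ((id K×₁ d A) K.⨾ N.n K.⨾ (d _ ⨾ u))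
          ≈⟨ ⨾-congˡ (⨾-congˡ ×₁-n-U) ⟩
        (id ⊗₁ ι₂) ⨾ ∂ _ ⨾ μ⁻¹ ⨾ (id ⊗₁ d A) ⨾ u
          ≈⟨ ⨾-congˡ (≈-trans assoc (⨾-congˡ assoc)) ⟨
        (id ⊗₁ ι₂) ⨾ (∂ _ ⨾ μ⁻¹ ⨾ (id ⊗₁ d A)) ⨾ u
          ≈⟨ pull ι₂-∂-μ⁻¹ ⟩
        (!₁ π₁ ⊗₁ id) ⨾ u
          ≈⟨ ⨾-congʳ (⊗-congʳ F!-d⨾) ⟨
        (N.F₁ (d _ ⨾ π₁) ⊗₁ id) ⨾ u
          ≈⟨ identityʳ ⟨
        ((N.F₁ (d _ ⨾ π₁) ⊗₁ id) ⨾ u) ⨾ id ∎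

  canonicalDifferential : GeneralisedDifferential canonicalLNL additive products
  canonicalDifferential = record
    { 𝒯     = 𝒯
    ; ls∘𝒯  = record
        { obj≡ = λ _ → refl
        ; mor≈ = λ _ → K.≈-trans K.identityʳ (K.≈-sym K.identityˡ) }
    ; φ-iso = λ _ _ → record
        { inv  = LS.id
        ; isoˡ = LS.≈-trans LS.identityʳ φ≈id
        ; isoʳ = LS.≈-trans LS.identityˡ φ≈id }
    ; 𝒯∘U   = λ _ → refl
    -- The cast and the inverse of `φ` are both `LS.id`, so `i₂U` reduces to its injection; the base
    -- equation is then the unit laws of `L!`.
    ; W-i₂  = λ h → LS.≈-trans (LS.⨾-congˡ i₂U-simplify)
        (LS.≈-trans (K.≈-trans K.identityʳ (K.≈-sym K.identityˡ) , W-fibre (base h) (fibre h))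
          (LS.⨾-congʳ (LS.≈-sym i₂U-simplify)))
    }
    where
      i₂U-simplify : ∀ {X A} → LS.id LS.⨾ (⟪ K.id , w⊗ ι₂ ⟫ LS.⨾ LS.id) LS.≈
                               ⟪ K.id {X ×₀ A} , w⊗ (ι₂ {X} {A}) ⟫
      i₂U-simplify = LS.≈-trans LS.identityˡ LS.identityʳ

      -- `comp-w⊗` makes the left side a postcomposition with `ι₂`, and `comp-id-w⊗` makes the right
      -- side a derivative along `ι₂`.
      W-fibre : ∀ {X A Y B} (f : !₀ X ⇒ Y) (u : !₀ X ⊗₀ A ⇒ B) →
                comp ⦃| f , u |⦄ ((N.F₁ (d (X ×₀ A) ⨾ π₁) ⊗₁ id) ⨾ u) (w⊗ ι₂) ≈
                comp K.id (w⊗ ι₂) (∂ _ ⨾ ⦃| f , u |⦄)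
      W-fibre f u = ≈-trans comp-w⊗ (≈-trans (≈-sym ι₂-∂-⦃⦄) (≈-sym comp-id-w⊗))

theorem4p7 : ∀ {o ℓ e} (S : DifferentialSeelyCategory o ℓ e) →
    let open DifferentialSeelyCategory S in
    GeneralisedDifferential (CanonicalLNL.canonicalLNL seelyCategory) additive products
theorem4p7 = CanonicalDifferential.canonicalDifferential
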